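{- Fix an integer $d\ge 3$. Let $(G_N)$ be a family of finite simple connected $d$-regular graphs, where $G_N$ has $N$ vertices and $N$ runs through an infinite set of positive integers, and fix an integer $j\ge 0$ such that the girth satisfies $g(G_N)\ge j+2$ for all sufficiently large $N$ in this set. Let $\beta_N=|E(G_N)|-|V(G_N)|+1$ be the cycle rank of $G_N$, and let $h_j(G_N)$ be the coefficient of $z^j$ in the $h$-polynomial of $\mathrm{BC}(G_N)$ (for any total ordering of $E(G_N)$). Then $$\beta_N=\left(\frac d2-1\right)N+1,$$ for all sufficiently large $N$, $$h_j(G_N)=\binom{\beta_N+j-1}{j},$$ and hence, as $N\to\infty$, $$h_j(G_N)\sim \frac1{j!}\left(\frac{d-2}{2}N\right)^j.$$ In particular, this applies to families $(G_N)$ of $d$-regular Ramanujan graphs satisfying this girth condition.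
   Context: The girth $g(G)$ is the length of a shortest cycle of $G$. A finite connected $d$-regular graph is Ramanujan if every eigenvalue $\theta$ of its adjacency matrix with $|\theta|\ne d$ satisfies $|\theta|\le 2\sqrt{d-1}$. The notation $a_N\sim b_N$ means $a_N/b_N\to 1$. For a finite connected loopless graph $G$ with a fixed total order on $E(G)$, a broken circuit is a set $C\setminus\{\max C\}$, where $C$ is the edge set of a cycle of $G$ and $\max C$ is its largest edge. The broken-circuit complex $\mathrm{BC}(G)$ is the simplicial complex on $E(G)$ whose faces are the edge sets containing no broken circuit. With $r=|V(G)|-1$ and $b_i$ the number of faces of $\mathrm{BC}(G)$ having exactly $i$ elements, the $h$-polynomial of $\mathrm{BC}(G)$ is $h_G(z)=\sum_{i=0}^{r}b_i z^i(1-z)^{r-i}$. -}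

module Defs where

open import Algebra.Bundles using (CommutativeRing)
import Algebra.Properties.Semiring.Exp as Exp
open import Data.Bool.Base using (if_then_else_)
import Data.Bool.Properties as Bool
open import Data.Fin.Base as Fin using (Fin; toℕ; fromℕ<)
import Data.Fin.Properties as Fin
open import Data.Fin.Subset using (Subset; inside; outside; _∈_; _⊆_; _-_; ∣_∣)
open import Data.Fin.Subset.Properties using (_∈?_; _⊆?_; anySubset?)
open import Data.Integer.Base as ℤ using (ℤ; +_; -[1+_]; 0ℤ; 1ℤ)
open import Data.List.Base as List using (List; []; _∷_)
open import Data.Nat.Base as ℕ using (ℕ; zero; suc; s≤s; _∸_; _!)
open import Data.Nat.Combinatorics using (_C_)
import Data.Nat.Properties as ℕ
open import Data.Product.Base using (Σ-syntax; ∃; ∃-syntax; _×_; _,_)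
open import Data.Product.Properties using (≡-dec)
open import Data.Rational.Base as ℚ using (ℚ; 0ℚ; 1ℚ; _/_; _÷_)
import Data.Rational.Properties as ℚ
open import Data.Rational.Solver using (module +-*-Solver)
open import Data.Sum.Base using (_⊎_; inj₁; inj₂)
open import Data.Vec.Base as Vec using (Vec; []; _∷_)
import Data.Vec.Functional as Vector
open import Data.Vec.Properties using () renaming (≡-dec to Vec-≡-dec)
open import Data.Vec.Relation.Unary.All as All using (All)
open import Data.Vec.Relation.Unary.AllPairs as AllPairs using ()
open import Data.Vec.Relation.Unary.Any as Any using (Any)
open import Data.Vec.Relation.Unary.Unique.Propositional using (Unique)
open import Data.Vec.Relation.Unary.Unique.Propositional.Properties using (lookup-injective)
open import Level using (0ℓ)
open import Relation.Binary.Construct.Closure.ReflexiveTransitive using (Star)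
open import Relation.Binary.Consequences using (total∧dec⇒dec)
open import Relation.Binary.Core using (Rel)
open import Relation.Binary.Definitions using (Decidable; Symmetric; Irreflexive)
open import Relation.Binary.PropositionalEquality
open import Relation.Binary.Structures using (IsTotalOrder)
open import Relation.Nullary.Decidable
  using (Dec; does; map′; ¬?; _×-dec_; _⊎-dec_; _→-dec_)
open import Relation.Nullary.Negation using (¬_)
open import Relation.Unary using (Pred) renaming (Decidable to Decidable₁)

record Graph (n : ℕ) : Set₁ where
  infix 4 _~_ _~?_
  field
    _~_     : Rel (Fin n) 0ℓ
    _~?_    : Decidable _~_
    ~-sym   : Symmetric _~_
    ~-irr   : Irreflexive _≡_ _~_

module _ {n : ℕ} (G : Graph n) where
  open Graph G

  degree : Fin n → ℕ
  degree v = List.length (List.filter (v ~?_) (List.allFin n))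

  Regular : ℕ → Set
  Regular d = ∀ v → degree v ≡ d

  Connected : Set
  Connected = ∀ u v → Star _~_ u v

  -- Each edge {u , v} is listed once, as the pair with u < v.
  edges : List (Fin n × Fin n)
  edges = List.filter (λ (u , v) → (u Fin.<? v) ×-dec (u ~? v))
                      (List.cartesianProduct (List.allFin n) (List.allFin n))

  edgeCount : ℕ
  edgeCount = List.length edges

  Edge : Set
  Edge = Fin edgeCount

  ends : Edge → Fin n × Fin n
  ends = List.lookup edges

  -- Truncated subtraction is exact here: a connected graph has
  -- ∣E∣ + 1 ≥ ∣V∣.
  cycleRank : ℕ
  cycleRank = edgeCount ℕ.+ 1 ∸ n

  -- v₀ , … , vₖ₋₁  ↦  (v₀ , v₁) , … , (vₖ₋₂ , vₖ₋₁) , (vₖ₋₁ , v₀)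
  steps : ∀ {k} → Vec (Fin n) k → Vec (Fin n × Fin n) k
  steps []       = []
  steps (v ∷ vs) = Vec.zip (v ∷ vs) (vs Vec.∷ʳ v)

  -- A cycle of length k, given by its vertices in cyclic order; k ≥ 3 since
  -- the graph is simple.
  IsCycle : ∀ {k} → Vec (Fin n) k → Set
  IsCycle {k} vs = 3 ℕ.≤ k × Unique vs × All (λ (u , v) → u ~ v) (steps vs)

  IsGirth : ℕ → Set
  IsGirth g = (Σ[ vs ∈ Vec (Fin n) g ] IsCycle vs)
            × (∀ {k} (vs : Vec (Fin n) k) → IsCycle vs → g ℕ.≤ k)

  Joins : Edge → Fin n × Fin n → Set
  Joins e (u , v) = ends e ≡ (u , v) ⊎ ends e ≡ (v , u)

  joins? : Decidable Joins
  joins? e (u , v) = (ends e ≟ (u , v)) ⊎-dec (ends e ≟ (v , u))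
    where _≟_ = ≡-dec Fin._≟_ Fin._≟_

  cycleEdges : ∀ {k} → Vec (Fin n) k → Subset edgeCount
  cycleEdges vs = Vec.tabulate λ e → does (Any.any? (joins? e) (steps vs))

  isCycle? : ∀ {k} → Decidable₁ (IsCycle {k})
  isCycle? {k} vs =
    (3 ℕ.≤? k)
    ×-dec AllPairs.allPairs? (λ u v → ¬? (u Fin.≟ v)) vs
    ×-dec All.all? (λ (u , v) → u ~? v) (steps vs)

  cycle-length≤n : ∀ {k} (vs : Vec (Fin n) k) → IsCycle vs → k ℕ.≤ n
  cycle-length≤n vs (_ , uniq , _) = Fin.injective⇒≤ (lookup-injective uniq _ _)

  record EdgeOrder : Set₁ where
    infix 4 _≼_
    field
      _≼_          : Rel Edge 0ℓ
      isTotalOrder : IsTotalOrder _≡_ _≼_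

anyVec? : ∀ {n} k {P : Pred (Vec (Fin n) k) 0ℓ} → Decidable₁ P → Dec (∃ P)
anyVec? zero    P? = map′ (λ p → [] , p) (λ { ([] , p) → p }) (P? [])
anyVec? (suc k) P? =
  map′ (λ (x , xs , p) → x ∷ xs , p) (λ { (x ∷ xs , p) → x , xs , p })
       (Fin.any? λ x → anyVec? k λ xs → P? (x ∷ xs))

subsets : ∀ m → List (Subset m)
subsets zero    = [] ∷ []
subsets (suc m) = List.map (outside ∷_) (subsets m)
             List.++ List.map (inside ∷_) (subsets m)

-- The coefficients of a polynomial over ℤ, constant term first.
Poly : Set
Poly = List ℤ

infixl 6 _⊕_
infixl 7 _⊗_
infixr 8 _⊗^_

_⊕_ : Poly → Poly → Poly
[]      ⊕ q       = q
(a ∷ p) ⊕ []      = a ∷ p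
(a ∷ p) ⊕ (b ∷ q) = a ℤ.+ b ∷ p ⊕ q

_⊗_ : Poly → Poly → Poly
[]      ⊗ q = []
(a ∷ p) ⊗ q = List.map (a ℤ.*_) q ⊕ (0ℤ ∷ p ⊗ q)

_⊗^_ : Poly → ℕ → Poly
p ⊗^ zero  = 1ℤ ∷ []
p ⊗^ suc k = p ⊗ p ⊗^ k

coeff : Poly → ℕ → ℤ
coeff []      _       = 0ℤ
coeff (a ∷ p) zero    = a
coeff (a ∷ p) (suc k) = coeff p k

constant : ℕ → Poly
constant b = + b ∷ []

z 1-z : Poly
z   = 0ℤ ∷ 1ℤ ∷ []
1-z = 1ℤ ∷ -[1+ 0 ] ∷ []

module BC {n : ℕ} (G : Graph n) (order : EdgeOrder G) where
  open EdgeOrder order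

  _≼?_ : Decidable _≼_
  _≼?_ = total∧dec⇒dec reflexive antisym total Fin._≟_
    where open IsTotalOrder isTotalOrder

  IsMaxOf : Subset (edgeCount G) → Edge G → Set
  IsMaxOf C e = e ∈ C × (∀ f → f ∈ C → f ≼ e)

  IsBrokenCircuit : Subset (edgeCount G) → Set
  IsBrokenCircuit B =
    ∃[ k ] Σ[ vs ∈ Vec (Fin n) k ] IsCycle G vs ×
      (∃[ e ] IsMaxOf (cycleEdges G vs) e × B ≡ cycleEdges G vs - e)

  IsFace : Subset (edgeCount G) → Set
  IsFace S = ¬ (∃[ B ] IsBrokenCircuit B × B ⊆ S)

  isMaxOf? : Decidable IsMaxOf
  isMaxOf? C e = (e ∈? C) ×-dec Fin.all? (λ f → (f ∈? C) →-dec (f ≼? e))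

  -- Cycles have length at most n, so the search is finite.
  isBrokenCircuit? : Decidable₁ IsBrokenCircuit
  isBrokenCircuit? B = map′
    (λ (k , rest) → toℕ k , rest)
    (λ (k , vs , cyc , rest) →
      let k<1+n = s≤s (cycle-length≤n G vs cyc) in
      fromℕ< k<1+n
      , subst Witness (sym (Fin.toℕ-fromℕ< k<1+n)) (vs , cyc , rest))
    (Fin.any? λ (k : Fin (suc n)) → anyVec? (toℕ k) λ vs →
      isCycle? G vs ×-dec
      Fin.any? λ e → isMaxOf? (cycleEdges G vs) e
                     ×-dec Vec-≡-dec Bool._≟_ B (cycleEdges G vs - e))
    where
    Witness : ℕ → Set
    Witness k = Σ[ vs ∈ Vec (Fin n) k ] IsCycle G vs ×
      (∃[ e ] IsMaxOf (cycleEdges G vs) e × B ≡ cycleEdges G vs - e)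

  isFace? : Decidable₁ IsFace
  isFace? S = ¬? (anySubset? λ B → isBrokenCircuit? B ×-dec (B ⊆? S))

  faceCount : ℕ → ℕ
  faceCount i = List.length
    (List.filter (λ S → isFace? S ×-dec (∣ S ∣ ℕ.≟ i)) (subsets (edgeCount G)))

  hPolynomial : Poly
  hPolynomial = List.foldr _⊕_ []
    (List.map (λ i → constant (faceCount i) ⊗ z ⊗^ i ⊗ 1-z ⊗^ (r ∸ i))
              (List.upTo (suc r)))
    where
    r : ℕ
    r = n ∸ 1

h : ∀ {n} (G : Graph n) → EdgeOrder G → ℕ → ℤ
h G order j = coeff (BC.hPolynomial G order) j

Cauchy : (ℕ → ℚ) → Set
Cauchy x = ∀ ε → 0ℚ ℚ.< ε →
  ∃[ M ] ∀ k l → M ℕ.≤ k → M ℕ.≤ l → ℚ.∣ x k ℚ.- x l ∣ ℚ.≤ ε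

-- Real numbers as Cauchy sequences of rationals, with equality _≃ℝ_.
record ℝ : Set where
  constructor mkℝ
  field
    approx : ℕ → ℚ
    cauchy : Cauchy approx

open ℝ public

infix  4 _≃ℝ_ _≤ℝ_
infixl 6 _+ℝ_
infixl 7 _*ℝ_

_≃ℝ_ _≤ℝ_ : Rel ℝ 0ℓ
x ≃ℝ y = ∀ ε → 0ℚ ℚ.< ε →
  ∃[ M ] ∀ k → M ℕ.≤ k → ℚ.∣ approx x k ℚ.- approx y k ∣ ℚ.≤ ε
x ≤ℝ y = ∀ ε → 0ℚ ℚ.< ε →
  ∃[ M ] ∀ k → M ℕ.≤ k → approx x k ℚ.≤ approx y k ℚ.+ ε

private
  open ℚ.≤-Reasoning

  EventuallyBounded : (ℕ → ℚ) → ℚ → Set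
  EventuallyBounded x B = ∃[ M ] ∀ k → M ℕ.≤ k → ℚ.∣ x k ∣ ℚ.≤ B

  EventuallyWithin : (ℕ → ℚ) → ℚ → Set
  EventuallyWithin x ε =
    ∃[ M ] ∀ k l → M ℕ.≤ k → M ℕ.≤ l → ℚ.∣ x k ℚ.- x l ∣ ℚ.≤ ε

private abstract

  swap-+ : ∀ a b c d → (a ℚ.+ b) ℚ.- (c ℚ.+ d) ≡ (a ℚ.- c) ℚ.+ (b ℚ.- d)
  swap-+ = solve 4 (λ a b c d → (a :+ b) :- (c :+ d) := (a :- c) :+ (b :- d)) refl
    where open +-*-Solver

  swap-* : ∀ a b c d → a ℚ.* b ℚ.- c ℚ.* d ≡ a ℚ.* (b ℚ.- d) ℚ.+ d ℚ.* (a ℚ.- c)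
  swap-* = solve 4 (λ a b c d → a :* b :- c :* d := a :* (b :- d) :+ d :* (a :- c)) refl
    where open +-*-Solver

  half-pos : ∀ {ε} → 0ℚ ℚ.< ε → 0ℚ ℚ.< ε ℚ.* ℚ.½
  half-pos {ε} ε>0 =
    ℚ.positive⁻¹ _ {{ℚ.pos*pos⇒pos ε {{ℚ.positive ε>0}} ℚ.½}}

  half+half : ∀ ε → ε ℚ.* ℚ.½ ℚ.+ ε ℚ.* ℚ.½ ≡ ε
  half+half ε = trans (sym (ℚ.*-distribˡ-+ ε ℚ.½ ℚ.½)) (ℚ.*-identityʳ ε)

  cauchy-+ : ∀ x y → Cauchy x → Cauchy y → Cauchy (λ k → x k ℚ.+ y k)
  cauchy-+ x y cx cy ε ε>0 =
    let (M , p) = cx _ (half-pos ε>0)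
        (L , q) = cy _ (half-pos ε>0)
    in M ℕ.⊔ L , λ k l k≥ l≥ → begin
      ℚ.∣ (x k ℚ.+ y k) ℚ.- (x l ℚ.+ y l) ∣
        ≡⟨ cong ℚ.∣_∣ (swap-+ (x k) (y k) (x l) (y l)) ⟩
      ℚ.∣ (x k ℚ.- x l) ℚ.+ (y k ℚ.- y l) ∣
        ≤⟨ ℚ.∣p+q∣≤∣p∣+∣q∣ (x k ℚ.- x l) _ ⟩
      ℚ.∣ x k ℚ.- x l ∣ ℚ.+ ℚ.∣ y k ℚ.- y l ∣
        ≤⟨ ℚ.+-mono-≤
             (p k l (ℕ.m⊔n≤o⇒m≤o M L k≥) (ℕ.m⊔n≤o⇒m≤o M L l≥))
             (q k l (ℕ.m⊔n≤o⇒n≤o M L k≥) (ℕ.m⊔n≤o⇒n≤o M L l≥)) ⟩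
      ε ℚ.* ℚ.½ ℚ.+ ε ℚ.* ℚ.½
        ≡⟨ half+half ε ⟩
      ε ∎

  bounded : ∀ x → Cauchy x →
    ∃[ B ] ℚ.Positive B × (∃[ M ] ∀ k → M ℕ.≤ k → ℚ.∣ x k ∣ ℚ.≤ B)
  bounded x cx =
    let (M , p) = cx 1ℚ (ℚ.positive⁻¹ 1ℚ)
    in ℚ.∣ x M ∣ ℚ.+ 1ℚ
     , ℚ.nonNeg+pos⇒pos ℚ.∣ x M ∣ {{ℚ.∣-∣-nonNeg (x M)}} 1ℚ
     , M , λ k k≥ → begin
      ℚ.∣ x k ∣                          ≡⟨ cong ℚ.∣_∣ (split (x k) (x M)) ⟩
      ℚ.∣ x M ℚ.+ (x k ℚ.- x M) ∣        ≤⟨ ℚ.∣p+q∣≤∣p∣+∣q∣ (x M) _ ⟩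
      ℚ.∣ x M ∣ ℚ.+ ℚ.∣ x k ℚ.- x M ∣    ≤⟨ ℚ.+-monoʳ-≤ ℚ.∣ x M ∣ (p k M k≥ ℕ.≤-refl) ⟩
      ℚ.∣ x M ∣ ℚ.+ 1ℚ                   ∎
    where
    split : ∀ a b → a ≡ b ℚ.+ (a ℚ.- b)
    split = solve 2 (λ a b → a := b :+ (a :- b)) refl
      where open +-*-Solver

  ∣*∣-bound : ∀ a b {A B} → ℚ.Positive A →
    ℚ.∣ a ∣ ℚ.≤ A → ℚ.∣ b ∣ ℚ.≤ B → ℚ.∣ a ℚ.* b ∣ ℚ.≤ A ℚ.* B
  ∣*∣-bound a b {A} {B} A>0 a≤ b≤ = begin
    ℚ.∣ a ℚ.* b ∣
      ≡⟨ ℚ.∣p*q∣≡∣p∣*∣q∣ a b ⟩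
    ℚ.∣ a ∣ ℚ.* ℚ.∣ b ∣
      ≤⟨ ℚ.*-monoʳ-≤-nonNeg ℚ.∣ b ∣ {{ℚ.∣-∣-nonNeg b}} a≤ ⟩
    A ℚ.* ℚ.∣ b ∣
      ≤⟨ ℚ.*-monoˡ-≤-nonNeg A {{ℚ.pos⇒nonNeg A {{A>0}}}} b≤ ⟩
    A ℚ.* B ∎

  product-bound : ∀ A B δ ε a b c d → ℚ.Positive A → ℚ.Positive B →
    (A ℚ.+ B) ℚ.* δ ≡ ε →
    ℚ.∣ a ∣ ℚ.≤ A → ℚ.∣ d ∣ ℚ.≤ B →
    ℚ.∣ a ℚ.- c ∣ ℚ.≤ δ → ℚ.∣ b ℚ.- d ∣ ℚ.≤ δ →
    ℚ.∣ a ℚ.* b ℚ.- c ℚ.* d ∣ ℚ.≤ ε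
  product-bound A B δ ε a b c d A>0 B>0 eq a≤ d≤ ac≤ bd≤ = begin
    ℚ.∣ a ℚ.* b ℚ.- c ℚ.* d ∣
      ≡⟨ cong ℚ.∣_∣ (swap-* a b c d) ⟩
    ℚ.∣ a ℚ.* (b ℚ.- d) ℚ.+ d ℚ.* (a ℚ.- c) ∣
      ≤⟨ ℚ.∣p+q∣≤∣p∣+∣q∣ (a ℚ.* (b ℚ.- d)) (d ℚ.* (a ℚ.- c)) ⟩
    ℚ.∣ a ℚ.* (b ℚ.- d) ∣ ℚ.+ ℚ.∣ d ℚ.* (a ℚ.- c) ∣
      ≤⟨ ℚ.+-mono-≤ (∣*∣-bound a (b ℚ.- d) A>0 a≤ bd≤)
                    (∣*∣-bound d (a ℚ.- c) B>0 d≤ ac≤) ⟩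
    A ℚ.* δ ℚ.+ B ℚ.* δ
      ≡⟨ ℚ.*-distribʳ-+ δ A B ⟨
    (A ℚ.+ B) ℚ.* δ
      ≡⟨ eq ⟩
    ε ∎

  split-tolerance : ∀ A ε → ℚ.Positive A → 0ℚ ℚ.< ε → ∃[ δ ] 0ℚ ℚ.< δ × A ℚ.* δ ≡ ε
  split-tolerance A ε A>0 ε>0 =
    1/A ℚ.* ε
    , ℚ.positive⁻¹ (1/A ℚ.* ε)
        {{ℚ.pos*pos⇒pos 1/A {{ℚ.1/pos⇒pos A {{A>0}}}} ε {{ℚ.positive ε>0}}}}
    , trans (sym (ℚ.*-assoc A 1/A ε))
        (trans (cong (ℚ._* ε) (ℚ.*-inverseʳ A {{A≢0}})) (ℚ.*-identityˡ ε))
    where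
    A≢0 : ℚ.NonZero A
    A≢0 = ℚ.pos⇒nonZero A {{A>0}}
    1/A : ℚ
    1/A = ℚ.1/_ A {{A≢0}}

  within-* : ∀ x y A B δ ε → ℚ.Positive A → ℚ.Positive B → (A ℚ.+ B) ℚ.* δ ≡ ε →
    EventuallyBounded x A → EventuallyBounded y B →
    EventuallyWithin x δ → EventuallyWithin y δ →
    EventuallyWithin (λ k → x k ℚ.* y k) ε
  within-* x y A B δ ε A>0 B>0 eq (K , a) (L , b) (M , p) (N , q) =
    (K ℕ.⊔ L) ℕ.⊔ (M ℕ.⊔ N) , λ k l k≥ l≥ →
      let k≥KL = ℕ.m⊔n≤o⇒m≤o (K ℕ.⊔ L) (M ℕ.⊔ N) k≥
          l≥KL = ℕ.m⊔n≤o⇒m≤o (K ℕ.⊔ L) (M ℕ.⊔ N) l≥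
          k≥MN = ℕ.m⊔n≤o⇒n≤o (K ℕ.⊔ L) (M ℕ.⊔ N) k≥
          l≥MN = ℕ.m⊔n≤o⇒n≤o (K ℕ.⊔ L) (M ℕ.⊔ N) l≥
      in product-bound A B δ ε (x k) (y k) (x l) (y l) A>0 B>0 eq
           (a k (ℕ.m⊔n≤o⇒m≤o K L k≥KL)) (b l (ℕ.m⊔n≤o⇒n≤o K L l≥KL))
           (p k l (ℕ.m⊔n≤o⇒m≤o M N k≥MN) (ℕ.m⊔n≤o⇒m≤o M N l≥MN))
           (q k l (ℕ.m⊔n≤o⇒n≤o M N k≥MN) (ℕ.m⊔n≤o⇒n≤o M N l≥MN))

  cauchy-* : ∀ x y → Cauchy x → Cauchy y → Cauchy (λ k → x k ℚ.* y k)
  cauchy-* x y cx cy ε ε>0 = combine (bounded x cx) (bounded y cy)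
    where
    combine : (∃[ A ] ℚ.Positive A × EventuallyBounded x A) →
              (∃[ B ] ℚ.Positive B × EventuallyBounded y B) →
              EventuallyWithin (λ k → x k ℚ.* y k) ε
    combine (A , A>0 , bx) (B , B>0 , by) = finish
      (split-tolerance (A ℚ.+ B) ε (ℚ.pos+pos⇒pos A {{A>0}} B {{B>0}}) ε>0)
      where
      finish : (∃[ δ ] 0ℚ ℚ.< δ × (A ℚ.+ B) ℚ.* δ ≡ ε) →
               EventuallyWithin (λ k → x k ℚ.* y k) ε
      finish (δ , δ>0 , eq) =
        within-* x y A B δ ε A>0 B>0 eq bx by (cx δ δ>0) (cy δ δ>0)

  cauchy-const : ∀ q → Cauchy (λ _ → q)
  cauchy-const q ε ε>0 = 0 , λ _ _ _ _ → begin
    ℚ.∣ q ℚ.- q ∣   ≡⟨ cong ℚ.∣_∣ (ℚ.+-inverseʳ q) ⟩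
    0ℚ              ≤⟨ ℚ.<⇒≤ ε>0 ⟩
    ε               ∎

  ∣a∣-∣b∣≤∣a-b∣ : ∀ a b → ℚ.∣ a ∣ ℚ.- ℚ.∣ b ∣ ℚ.≤ ℚ.∣ a ℚ.- b ∣
  ∣a∣-∣b∣≤∣a-b∣ a b = begin
    ℚ.∣ a ∣ ℚ.- ℚ.∣ b ∣
      ≡⟨ cong (λ c → ℚ.∣ c ∣ ℚ.- ℚ.∣ b ∣) (split a b) ⟩
    ℚ.∣ (a ℚ.- b) ℚ.+ b ∣ ℚ.- ℚ.∣ b ∣
      ≤⟨ ℚ.+-monoˡ-≤ (ℚ.- ℚ.∣ b ∣) (ℚ.∣p+q∣≤∣p∣+∣q∣ (a ℚ.- b) b) ⟩
    (ℚ.∣ a ℚ.- b ∣ ℚ.+ ℚ.∣ b ∣) ℚ.- ℚ.∣ b ∣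
      ≡⟨ cancel ℚ.∣ a ℚ.- b ∣ ℚ.∣ b ∣ ⟩
    ℚ.∣ a ℚ.- b ∣ ∎
    where
    open +-*-Solver
    split : ∀ a b → a ≡ (a ℚ.- b) ℚ.+ b
    split = solve 2 (λ a b → a := (a :- b) :+ b) refl
    cancel : ∀ c d → (c ℚ.+ d) ℚ.- d ≡ c
    cancel = solve 2 (λ c d → (c :+ d) :- d := c) refl

  neg-sub : ∀ a b → ℚ.- (a ℚ.- b) ≡ b ℚ.- a
  neg-sub = solve 2 (λ a b → :- (a :- b) := b :- a) refl
    where open +-*-Solver

  ∣∣a∣-∣b∣∣≤∣a-b∣ : ∀ a b → ℚ.∣ ℚ.∣ a ∣ ℚ.- ℚ.∣ b ∣ ∣ ℚ.≤ ℚ.∣ a ℚ.- b ∣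
  ∣∣a∣-∣b∣∣≤∣a-b∣ a b with ℚ.∣p∣≡p∨∣p∣≡-p (ℚ.∣ a ∣ ℚ.- ℚ.∣ b ∣)
  ... | inj₁ eq = subst (ℚ._≤ ℚ.∣ a ℚ.- b ∣) (sym eq) (∣a∣-∣b∣≤∣a-b∣ a b)
  ... | inj₂ eq = begin
    ℚ.∣ ℚ.∣ a ∣ ℚ.- ℚ.∣ b ∣ ∣     ≡⟨ eq ⟩
    ℚ.- (ℚ.∣ a ∣ ℚ.- ℚ.∣ b ∣)     ≡⟨ neg-sub ℚ.∣ a ∣ ℚ.∣ b ∣ ⟩
    ℚ.∣ b ∣ ℚ.- ℚ.∣ a ∣           ≤⟨ ∣a∣-∣b∣≤∣a-b∣ b a ⟩
    ℚ.∣ b ℚ.- a ∣                 ≡⟨ ℚ.∣-p∣≡∣p∣ (b ℚ.- a) ⟨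
    ℚ.∣ ℚ.- (b ℚ.- a) ∣           ≡⟨ cong ℚ.∣_∣ (neg-sub b a) ⟩
    ℚ.∣ a ℚ.- b ∣                 ∎

  cauchy-∣∣ : ∀ x → Cauchy x → Cauchy (λ k → ℚ.∣ x k ∣)
  cauchy-∣∣ x cx ε ε>0 =
    let (M , p) = cx ε ε>0
    in M , λ k l k≥ l≥ → ℚ.≤-trans (∣∣a∣-∣b∣∣≤∣a-b∣ (x k) (x l)) (p k l k≥ l≥)

fromℚ : ℚ → ℝ
fromℚ q = mkℝ (λ _ → q) (cauchy-const q)

0ℝ : ℝ
0ℝ = fromℚ 0ℚ

_+ℝ_ _*ℝ_ : ℝ → ℝ → ℝ
x +ℝ y = mkℝ (λ k → approx x k ℚ.+ approx y k) (cauchy-+ (approx x) (approx y) (cauchy x) (cauchy y))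
x *ℝ y = mkℝ (λ k → approx x k ℚ.* approx y k) (cauchy-* (approx x) (approx y) (cauchy x) (cauchy y))

∣_∣ℝ : ℝ → ℝ
∣ x ∣ℝ = mkℝ (λ k → ℚ.∣ approx x k ∣) (cauchy-∣∣ (approx x) (cauchy x))

sumℝ : ∀ {n} → (Fin n → ℝ) → ℝ
sumℝ = Vector.foldr _+ℝ_ 0ℝ

-- The square root as a relation: such an s is unique up to _≃ℝ_.
_IsSqrtOf_ : ℝ → ℝ → Set
s IsSqrtOf a = 0ℝ ≤ℝ s × s *ℝ s ≃ℝ a

fromℕ : ℕ → ℚ
fromℕ n = + n / 1

module _ {n : ℕ} (G : Graph n) where
  open Graph G

  adjacencyMatrix : Fin n → Fin n → ℝ
  adjacencyMatrix u v = if does (u ~? v) then fromℚ 1ℚ else 0ℝ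

  -- Real eigenvalues suffice, the adjacency matrix being symmetric.
  IsEigenvalue : ℝ → Set
  IsEigenvalue θ = Σ[ x ∈ (Fin n → ℝ) ]
    ¬ (∀ u → x u ≃ℝ 0ℝ) ×
    (∀ u → sumℝ (λ v → adjacencyMatrix u v *ℝ x v) ≃ℝ θ *ℝ x u)

  record IsRamanujan (d : ℕ) : Set where
    field
      connected : Connected G
      regular   : Regular G d
      bound     : ∀ θ → IsEigenvalue θ → ¬ (∣ θ ∣ℝ ≃ℝ fromℚ (fromℕ d)) →
                  Σ[ s ∈ ℝ ] s IsSqrtOf fromℚ (fromℕ d ℚ.- 1ℚ)
                           × ∣ θ ∣ℝ ≤ℝ fromℚ (fromℕ 2) *ℝ s

-- Irrelevance of the membership proof makes the graph depend on N alone.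
record RegularFamily (d : ℕ) : Set₁ where
  field
    Index     : Pred ℕ 0ℓ
    positive  : ∀ {N} → Index N → 1 ℕ.≤ N
    infinite  : ∀ M → ∃[ N ] M ℕ.≤ N × Index N
    graph     : ∀ N → .(Index N) → Graph N
    connected : ∀ N (i : Index N) → Connected (graph N i)
    regular   : ∀ N (i : Index N) → Regular (graph N i) d

module _ (Index : Pred ℕ 0ℓ) where

  Eventually : (∀ N → .(Index N) → Set) → Set
  Eventually P = ∃[ M ] ∀ N (i : Index N) → M ℕ.≤ N → P N i

  -- a N / b N → 1, with b N ≠ 0 eventually so that the quotient makes sense.
  Asymptotic : (a b : ∀ N → .(Index N) → ℚ) → Set
  Asymptotic a b = ∀ ε → 0ℚ ℚ.< ε → Eventually λ N i →
    Σ[ b≢0 ∈ ℚ.NonZero (b N i) ] ℚ.∣ _÷_ (a N i) (b N i) {{b≢0}} ℚ.- 1ℚ ∣ ℚ.< ε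

open Exp (CommutativeRing.semiring ℚ.+-*-commutativeRing) public
  using () renaming (_^_ to _^ℚ_)

module _ {d : ℕ} (F : RegularFamily d) where
  open RegularFamily F

  EdgeOrders : Set₁
  EdgeOrders = ∀ N .(i : Index N) → EdgeOrder (graph N i)

  GirthEventually≥ : ℕ → Set
  GirthEventually≥ m = Eventually Index λ N i →
    ∃[ g ] IsGirth (graph N i) g × m ℕ.≤ g

  CycleRankFormula : Set
  CycleRankFormula = ∀ N (i : Index N) →
    fromℕ (cycleRank (graph N i)) ≡ (+ d / 2 ℚ.- 1ℚ) ℚ.* fromℕ N ℚ.+ 1ℚ

  -- The subtraction is exact: the cycle rank is positive for d ≥ 2.
  HFormula : ℕ → EdgeOrders → Set
  HFormula j order = Eventually Index λ N i →
    h (graph N i) (order N i) j ≡ + ((cycleRank (graph N i) ℕ.+ j ∸ 1) C j)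

  HAsymptotics : ℕ → EdgeOrders → Set
  HAsymptotics j order = Asymptotic Index
    (λ N i → h (graph N i) (order N i) j / 1)
    (λ N _ → (_/_ 1ℤ (j !) {{j ℕ.!≢0}})
               ℚ.* ((((+ d ℤ.- + 2) / 2) ℚ.* fromℕ N) ^ℚ j))

{-# OPTIONS --safe #-}
-- A cycle of length k has k edges, so a broken circuit has at least g − 1 ≥ j + 1
-- edges and every set of at most j edges is a face: bᵢ = C(E, i) for i ≤ j. As far
-- as the coefficient of zʲ is concerned, h is then Σ C(E, i) zⁱ (1 − z)^(r − i),
-- and with s = r − j this coefficient is the one of xʲ in (1 + x)^E (1 + x)^ -(s + 1),
-- namely C(E − s − 1, j) = C(β + j − 1, j). By the handshake lemma β = x + 1 with
-- x = (d/2 − 1) N, and C(x + j, j) = (x + 1) ⋯ (x + j) / j! ~ xʲ / j!.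
module Submission where

open import Defs
open import Data.Bool.Base using (true; false; if_then_else_)
open import Data.Fin.Base as Fin using (Fin; toℕ)
import Data.Fin.Properties as Fin
open import Data.Fin.Subset using (Subset; inside; outside; _∈_; _-_; ∣_∣)
open import Data.Fin.Subset.Properties
  using (x∈p∧x≢y⇒x∈p-y; x∈p⇒∣p-x∣<∣p∣; p⊆q⇒∣p∣≤∣q∣; p─⊥≡p)
open import Data.Integer.Base as ℤ using (ℤ; +_; 0ℤ; 1ℤ; -[1+_])
import Data.Integer.Properties as ℤ
import Data.Integer.Tactic.RingSolver as ℤ
open import Data.List.Base as List using ([]; _∷_; foldr; applyUpTo; upTo)
open import Data.List.Membership.Propositional.Properties
  using (∈-filter⁺; ∈-cartesianProduct⁺; ∈-allFin)
import Data.List.Properties as List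
import Data.List.Relation.Unary.All as LAll
import Data.List.Relation.Unary.Any as LAny
import Data.List.Relation.Unary.Any.Properties as LAny
open import Data.Nat.Base as ℕ using (ℕ; zero; suc; z≤n; s≤s; _≤_; _+_; _∸_; _!)
open import Data.Nat.Combinatorics
  using (_C_; nCk+nC[k+1]≡[n+1]C[k+1]; k>n⇒nCk≡0; nCk≡n!/k![n-k]!; k![n∸k]!∣n!)
import Data.Nat.Coprimality as ℕ
import Data.Nat.DivMod as ℕ
import Data.Nat.Properties as ℕ
import Data.Nat.Tactic.RingSolver as ℕ
open import Algebra.Properties.CommutativeMonoid.Sum ℕ.+-0-commutativeMonoid
  using (sum; ∑-distrib-+; ∑-comm; sum-cong-≗)
open import Data.Product.Base using (Σ-syntax; ∃-syntax; _×_; _,_; proj₁; proj₂)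
open import Data.Rational.Base as ℚ
  using (ℚ; 0ℚ; 1ℚ; ½; _/_; _÷_; mkℚ; *≤*; *<*)
import Data.Rational.Properties as ℚ
open import Data.Rational.Solver using (module +-*-Solver)
open import Data.Sum.Base using (_⊎_; inj₁; inj₂)
open import Data.Vec.Base as Vec using (Vec; []; _∷_)
import Data.Vec.Membership.Propositional.Properties as Vec
import Data.Vec.Properties as Vec
import Data.Vec.Relation.Unary.All as All
import Data.Vec.Relation.Unary.Any as Any
open import Data.Vec.Relation.Unary.Unique.Propositional.Properties using (lookup-injective)
open import Function.Base using (_∘_; id)
open import Level using (Level)
open import Relation.Binary.Definitions using (tri<; tri≈; tri>)
open import Relation.Binary.PropositionalEquality
open import Relation.Nullary.Decidable
  using (Dec; yes; no; does; dec-true; dec-false; _×-dec_)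
open import Relation.Nullary.Negation using (¬_; contradiction)
open import Relation.Unary using (Pred) renaming (Decidable to Decidable₁)

open ≡-Reasoning

-- The exponent of 1 - z in h varies with i, so the sum is not visibly a product. What makes it one
-- is that the i-th term contributes the coefficient of degree k = j - i in (1 - z)^(r - i), and r -
-- i = k + s. This is (-1)ᵏ C(k + s, k), which for fixed s depends on k alone and is the coefficient
-- of xᵏ in (1 + x)^ -(s + 1): a single power series serves all i. Here s = r - j has to be a
-- natural number. The girth hypothesis supplies this too, since a cycle of length g ≥ j + 2 exists
-- and forces at least j + 2 vertices. The asymptotics rest on explicit bounds: for x ≥ 1, xʲ ≤ (x +
-- 1) ⋯ (x + j) ≤ (1 + K / x) xʲ with K depending only on j, and d ≥ 3 gives N ≤ 2x, which turns a
-- tolerance into a threshold for N.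

private
  variable
    ℓ p : Level
    A B : Set ℓ

-- Coefficients of the h-polynomial

coeff-⊕ : ∀ p q n → coeff (p ⊕ q) n ≡ coeff p n ℤ.+ coeff q n
coeff-⊕ []      q       n       = sym (ℤ.+-identityˡ _)
coeff-⊕ (a ∷ p) []      n       = sym (ℤ.+-identityʳ _)
coeff-⊕ (a ∷ p) (b ∷ q) zero    = refl
coeff-⊕ (a ∷ p) (b ∷ q) (suc n) = coeff-⊕ p q n

coeff-scale : ∀ a q n → coeff (List.map (a ℤ.*_) q) n ≡ a ℤ.* coeff q n
coeff-scale a []      n       = sym (ℤ.*-zeroʳ a)
coeff-scale a (b ∷ q) zero    = refl
coeff-scale a (b ∷ q) (suc n) = coeff-scale a q n

coeff-∷-⊗ : ∀ a p q n →
  coeff ((a ∷ p) ⊗ q) n ≡ a ℤ.* coeff q n ℤ.+ coeff (0ℤ ∷ p ⊗ q) n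
coeff-∷-⊗ a p q n = begin
  coeff ((a ∷ p) ⊗ q) n
    ≡⟨ coeff-⊕ (List.map (a ℤ.*_) q) (0ℤ ∷ p ⊗ q) n ⟩
  coeff (List.map (a ℤ.*_) q) n ℤ.+ coeff (0ℤ ∷ p ⊗ q) n
    ≡⟨ cong (ℤ._+ coeff (0ℤ ∷ p ⊗ q) n) (coeff-scale a q n) ⟩
  a ℤ.* coeff q n ℤ.+ coeff (0ℤ ∷ p ⊗ q) n ∎

-- Multiplication by zⁱ on coefficient sequences. Together with `δ`, the series 1, it describes the
-- monomial zⁱ as `shift i δ`.
shift : ℕ → (ℕ → ℤ) → ℕ → ℤ
shift zero    f n       = f n
shift (suc i) f zero    = 0ℤ
shift (suc i) f (suc n) = shift i f n

shift-cong : ∀ i {f g} → f ≗ g → shift i f ≗ shift i g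
shift-cong zero    f≗g n       = f≗g n
shift-cong (suc i) f≗g zero    = refl
shift-cong (suc i) f≗g (suc n) = shift-cong i f≗g n

δ : ℕ → ℤ
δ zero    = 1ℤ
δ (suc _) = 0ℤ

-- A list of zeros represents the zero polynomial as well as `[]` does, so vanishing is expressed
-- through coefficients.
coeff-zero-⊗ : ∀ p q → coeff p ≗ (λ _ → 0ℤ) → coeff (p ⊗ q) ≗ (λ _ → 0ℤ)
coeff-zero-⊗ []      q p≗0 n = refl
coeff-zero-⊗ (a ∷ p) q p≗0 n = begin
  coeff ((a ∷ p) ⊗ q) n                          ≡⟨ coeff-∷-⊗ a p q n ⟩
  a ℤ.* coeff q n ℤ.+ coeff (0ℤ ∷ p ⊗ q) n
    ≡⟨ cong₂ (λ x y → x ℤ.* coeff q n ℤ.+ y) (p≗0 zero) (tail n) ⟩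
  0ℤ ℤ.* coeff q n ℤ.+ 0ℤ                        ≡⟨ ℤ.+-identityʳ _ ⟩
  0ℤ ℤ.* coeff q n                               ≡⟨ ℤ.*-zeroˡ (coeff q n) ⟩
  0ℤ                                             ∎
  where
  tail : ∀ n → coeff (0ℤ ∷ p ⊗ q) n ≡ 0ℤ
  tail zero    = refl
  tail (suc n) = coeff-zero-⊗ p q (p≗0 ∘ suc) n

-- Describing p by its coefficients makes the lemma independent of the list that represents bzⁱ.
-- Even `[]` qualifies, and then the coefficient of degree i forces b = 0.
coeff-monomial-⊗ : ∀ b i p q → coeff p ≗ (λ k → b ℤ.* shift i δ k) →
  ∀ n → coeff (p ⊗ q) n ≡ b ℤ.* shift i (coeff q) n
coeff-monomial-⊗ b i [] q p≗ n = sym (begin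
  b ℤ.* shift i (coeff q) n    ≡⟨ cong (ℤ._* shift i (coeff q) n) b≡0 ⟩
  0ℤ ℤ.* shift i (coeff q) n   ≡⟨ ℤ.*-zeroˡ (shift i (coeff q) n) ⟩
  0ℤ                           ∎)
  where
  shift-δ : ∀ i → shift i δ i ≡ 1ℤ
  shift-δ zero    = refl
  shift-δ (suc i) = shift-δ i
  b≡0 : b ≡ 0ℤ
  b≡0 = begin
    b                    ≡⟨ ℤ.*-identityʳ b ⟨
    b ℤ.* 1ℤ             ≡⟨ cong (b ℤ.*_) (shift-δ i) ⟨
    b ℤ.* shift i δ i    ≡⟨ p≗ i ⟨
    0ℤ                   ∎
coeff-monomial-⊗ b zero (a ∷ p) q p≗ n = begin
  coeff ((a ∷ p) ⊗ q) n                          ≡⟨ coeff-∷-⊗ a p q n ⟩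
  a ℤ.* coeff q n ℤ.+ coeff (0ℤ ∷ p ⊗ q) n
    ≡⟨ cong₂ (λ x y → x ℤ.* coeff q n ℤ.+ y) (trans (p≗ zero) (ℤ.*-identityʳ b)) (tail n) ⟩
  b ℤ.* coeff q n ℤ.+ 0ℤ                         ≡⟨ ℤ.+-identityʳ _ ⟩
  b ℤ.* coeff q n                                ∎
  where
  tail : ∀ n → coeff (0ℤ ∷ p ⊗ q) n ≡ 0ℤ
  tail zero    = refl
  tail (suc n) =
    coeff-zero-⊗ p q (λ k → trans (p≗ (suc k)) (ℤ.*-zeroʳ b)) n
coeff-monomial-⊗ b (suc i) (a ∷ p) q p≗ n = begin
  coeff ((a ∷ p) ⊗ q) n                          ≡⟨ coeff-∷-⊗ a p q n ⟩
  a ℤ.* coeff q n ℤ.+ coeff (0ℤ ∷ p ⊗ q) n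
    ≡⟨ cong (λ x → x ℤ.* coeff q n ℤ.+ coeff (0ℤ ∷ p ⊗ q) n)
            (trans (p≗ zero) (ℤ.*-zeroʳ b)) ⟩
  0ℤ ℤ.* coeff q n ℤ.+ coeff (0ℤ ∷ p ⊗ q) n
    ≡⟨ cong (ℤ._+ coeff (0ℤ ∷ p ⊗ q) n) (ℤ.*-zeroˡ (coeff q n)) ⟩
  0ℤ ℤ.+ coeff (0ℤ ∷ p ⊗ q) n                    ≡⟨ ℤ.+-identityˡ _ ⟩
  coeff (0ℤ ∷ p ⊗ q) n                           ≡⟨ tail n ⟩
  b ℤ.* shift (suc i) (coeff q) n                ∎
  where
  tail : ∀ n → coeff (0ℤ ∷ p ⊗ q) n ≡ b ℤ.* shift (suc i) (coeff q) n
  tail zero    = sym (ℤ.*-zeroʳ b)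
  tail (suc n) = coeff-monomial-⊗ b i p q (p≗ ∘ suc) n

coeff-z^ : ∀ i → coeff (z ⊗^ i) ≗ shift i δ
coeff-z^ zero    zero    = refl
coeff-z^ zero    (suc n) = refl
coeff-z^ (suc i) n       = begin
  coeff (z ⊗ z ⊗^ i) n
    ≡⟨ coeff-monomial-⊗ 1ℤ 1 z (z ⊗^ i) coeff-z n ⟩
  1ℤ ℤ.* shift 1 (coeff (z ⊗^ i)) n    ≡⟨ ℤ.*-identityˡ _ ⟩
  shift 1 (coeff (z ⊗^ i)) n           ≡⟨ shift-cong 1 (coeff-z^ i) n ⟩
  shift 1 (shift i δ) n                ≡⟨ shift-suc n ⟩
  shift (suc i) δ n                    ∎
  where
  coeff-z : coeff z ≗ (λ k → 1ℤ ℤ.* shift 1 δ k)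
  coeff-z zero          = refl
  coeff-z (suc zero)    = refl
  coeff-z (suc (suc n)) = refl
  shift-suc : ∀ n → shift 1 (shift i δ) n ≡ shift (suc i) δ n
  shift-suc zero    = refl
  shift-suc (suc n) = refl

coeff-bz^-⊗ : ∀ b i q n →
  coeff (constant b ⊗ z ⊗^ i ⊗ q) n ≡ + b ℤ.* shift i (coeff q) n
coeff-bz^-⊗ b i q = coeff-monomial-⊗ (+ b) i (constant b ⊗ z ⊗^ i) q λ n → begin
  coeff (constant b ⊗ z ⊗^ i) n
    ≡⟨ coeff-monomial-⊗ (+ b) 0 (constant b) (z ⊗^ i) coeff-constant n ⟩
  + b ℤ.* coeff (z ⊗^ i) n         ≡⟨ cong (+ b ℤ.*_) (coeff-z^ i n) ⟩
  + b ℤ.* shift i δ n              ∎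
  where
  coeff-constant : coeff (constant b) ≗ (λ k → + b ℤ.* δ k)
  coeff-constant zero    = sym (ℤ.*-identityʳ (+ b))
  coeff-constant (suc n) = sym (ℤ.*-zeroʳ (+ b))

-- The coefficient of zⁿ in (1 − z)ᵏ.
signedC : ℕ → ℕ → ℤ
signedC k n = coeff (1-z ⊗^ k) n

coeff-1-z-⊗ : ∀ q n → coeff (1-z ⊗ q) n ≡ coeff q n ℤ.- shift 1 (coeff q) n
coeff-1-z-⊗ q n = begin
  coeff (1-z ⊗ q) n
    ≡⟨ coeff-∷-⊗ 1ℤ (-[1+ 0 ] ∷ []) q n ⟩
  1ℤ ℤ.* coeff q n ℤ.+ coeff (0ℤ ∷ (-[1+ 0 ] ∷ []) ⊗ q) n
    ≡⟨ cong₂ ℤ._+_ (ℤ.*-identityˡ (coeff q n)) (tail n) ⟩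
  coeff q n ℤ.- shift 1 (coeff q) n ∎
  where
  minus-one : coeff (-[1+ 0 ] ∷ []) ≗ (λ k → -[1+ 0 ] ℤ.* δ k)
  minus-one zero    = refl
  minus-one (suc n) = refl
  tail : ∀ n → coeff (0ℤ ∷ (-[1+ 0 ] ∷ []) ⊗ q) n ≡ ℤ.- shift 1 (coeff q) n
  tail zero    = refl
  tail (suc n) = trans (coeff-monomial-⊗ -[1+ 0 ] 0 (-[1+ 0 ] ∷ []) q minus-one n)
                       (ℤ.-1*i≡-i (coeff q n))

signedC-suc-zero : ∀ k → signedC (suc k) 0 ≡ signedC k 0
signedC-suc-zero k = trans (coeff-1-z-⊗ (1-z ⊗^ k) 0) (ℤ.+-identityʳ _)

-- Pascal's rule with signs, `signedC k n` being (-1)ⁿ C(k, n).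
signedC-suc-suc : ∀ k n →
  signedC (suc k) (suc n) ≡ signedC k (suc n) ℤ.- signedC k n
signedC-suc-suc k n = coeff-1-z-⊗ (1-z ⊗^ k) (suc n)

signedC-zero : ∀ k → signedC k 0 ≡ 1ℤ
signedC-zero zero    = refl
signedC-zero (suc k) = trans (signedC-suc-zero k) (signedC-zero k)

signedC-> : ∀ {k n} → k ℕ.< n → signedC k n ≡ 0ℤ
signedC-> {zero}  {suc n} k<n       = refl
signedC-> {suc k} {suc n} (s≤s k<n) = begin
  signedC (suc k) (suc n)             ≡⟨ signedC-suc-suc k n ⟩
  signedC k (suc n) ℤ.- signedC k n
    ≡⟨ cong₂ ℤ._-_ (signedC-> (ℕ.m<n⇒m<1+n k<n)) (signedC-> k<n) ⟩
  0ℤ                                  ∎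

-- Cauchy products and negative powers of 1 + z

infix 8 _⋆_

-- The Cauchy product Σ f i · g (n - i). Recursion drops the first coefficient of f and lowers the
-- degree together, so no truncated subtraction appears.
_⋆_ : (ℕ → ℤ) → (ℕ → ℤ) → ℕ → ℤ
(f ⋆ g) zero    = f 0 ℤ.* g 0
(f ⋆ g) (suc n) = f 0 ℤ.* g (suc n) ℤ.+ (f ∘ suc ⋆ g) n

-- Agreement is asked only up to degree n because the face numbers are known only up to size j.
⋆-congˡ : ∀ {f f′} g n → (∀ {i} → i ℕ.≤ n → f i ≡ f′ i) → (f ⋆ g) n ≡ (f′ ⋆ g) n
⋆-congˡ g zero    f≡ = cong (ℤ._* g 0) (f≡ z≤n)
⋆-congˡ g (suc n) f≡ =
  cong₂ ℤ._+_ (cong (ℤ._* g (suc n)) (f≡ z≤n)) (⋆-congˡ g n (f≡ ∘ s≤s))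

⋆-congʳ : ∀ f {g g′} → g ≗ g′ → f ⋆ g ≗ f ⋆ g′
⋆-congʳ f g≗ zero    = cong (f 0 ℤ.*_) (g≗ 0)
⋆-congʳ f g≗ (suc n) = cong₂ ℤ._+_ (cong (f 0 ℤ.*_) (g≗ (suc n))) (⋆-congʳ (f ∘ suc) g≗ n)

⋆-δ : ∀ f → f ⋆ δ ≗ f
⋆-δ f zero    = ℤ.*-identityʳ (f 0)
⋆-δ f (suc n) = begin
  f 0 ℤ.* 0ℤ ℤ.+ (f ∘ suc ⋆ δ) n
    ≡⟨ cong₂ ℤ._+_ (ℤ.*-zeroʳ (f 0)) (⋆-δ (f ∘ suc) n) ⟩
  0ℤ ℤ.+ f (suc n)                  ≡⟨ ℤ.+-identityˡ _ ⟩
  f (suc n)                         ∎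

[1+z]· : (ℕ → ℤ) → ℕ → ℤ
[1+z]· f zero    = f 0
[1+z]· f (suc n) = f (suc n) ℤ.+ f n

-- Dropping the first coefficient does not commute with `[1+z]·`: the sequences `[1+z]· f ∘ suc` and
-- `[1+z]· (f ∘ suc)` differ by f 0 in degree zero and agree elsewhere. The summand `f 0 ℤ.* g n` is
-- this defect, and carrying it along lets the induction close.
⋆-suc-[1+z]· : ∀ f g n →
  (f ∘ suc ⋆ [1+z]· g) n ℤ.+ f 0 ℤ.* g n ≡ ([1+z]· f ∘ suc ⋆ g) n
⋆-suc-[1+z]· f g zero    =
  solved (f 0) (f 1) (g 0)
  where
  solved : ∀ a b x → b ℤ.* x ℤ.+ a ℤ.* x ≡ (b ℤ.+ a) ℤ.* x
  solved = ℤ.solve-∀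
⋆-suc-[1+z]· f g (suc n) = begin
  f 1 ℤ.* (g (suc n) ℤ.+ g n) ℤ.+ (f ∘ suc ∘ suc ⋆ [1+z]· g) n ℤ.+ f 0 ℤ.* g (suc n)
    ≡⟨ regroup (f 0) (f 1) (g n) (g (suc n)) _ ⟩
  (f 1 ℤ.+ f 0) ℤ.* g (suc n) ℤ.+ ((f ∘ suc ∘ suc ⋆ [1+z]· g) n ℤ.+ f 1 ℤ.* g n)
    ≡⟨ cong (ℤ._+_ ((f 1 ℤ.+ f 0) ℤ.* g (suc n))) (⋆-suc-[1+z]· (f ∘ suc) g n) ⟩
  (f 1 ℤ.+ f 0) ℤ.* g (suc n) ℤ.+ ([1+z]· (f ∘ suc) ∘ suc ⋆ g) n ∎
  where
  regroup : ∀ a b x y w →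
    b ℤ.* (y ℤ.+ x) ℤ.+ w ℤ.+ a ℤ.* y ≡ (b ℤ.+ a) ℤ.* y ℤ.+ (w ℤ.+ b ℤ.* x)
  regroup = ℤ.solve-∀

-- Both sides are (1 + z) f g. This hands a factor of (1 + z)^E over to the negative power, where it
-- cancels.
[1+z]·-⋆ : ∀ f g → [1+z]· f ⋆ g ≗ f ⋆ [1+z]· g
[1+z]·-⋆ f g zero    = refl
[1+z]·-⋆ f g (suc n) = begin
  f 0 ℤ.* g (suc n) ℤ.+ ([1+z]· f ∘ suc ⋆ g) n
    ≡⟨ cong (ℤ._+_ (f 0 ℤ.* g (suc n))) (⋆-suc-[1+z]· f g n) ⟨
  f 0 ℤ.* g (suc n) ℤ.+ ((f ∘ suc ⋆ [1+z]· g) n ℤ.+ f 0 ℤ.* g n)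
    ≡⟨ regroup (f 0) (g n) (g (suc n)) _ ⟩
  f 0 ℤ.* (g (suc n) ℤ.+ g n) ℤ.+ (f ∘ suc ⋆ [1+z]· g) n ∎
  where
  regroup : ∀ a x y w → a ℤ.* y ℤ.+ (w ℤ.+ a ℤ.* x) ≡ a ℤ.* (y ℤ.+ x) ℤ.+ w
  regroup = ℤ.solve-∀

-- The coefficients of (1 + z)^ -(s + 1).
negC : ℕ → ℕ → ℤ
negC s n = signedC (n ℕ.+ s) n

-- `negC 0` is the geometric series 1 / (1 + z). By the signed Pascal rule the two neighbouring
-- coefficients add up to one of degree n + 1 in (1 - z)ⁿ, which is beyond the degree.
[1+z]·-negC-zero : [1+z]· (negC 0) ≗ δ
[1+z]·-negC-zero zero    = refl
[1+z]·-negC-zero (suc n) rewrite ℕ.+-identityʳ n = begin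
  signedC (suc n) (suc n) ℤ.+ signedC n n
    ≡⟨ cong (ℤ._+ signedC n n) (signedC-suc-suc n n) ⟩
  signedC n (suc n) ℤ.- signedC n n ℤ.+ signedC n n
    ≡⟨ cancel (signedC n (suc n)) (signedC n n) ⟩
  signedC n (suc n)
    ≡⟨ signedC-> (ℕ.n<1+n n) ⟩
  0ℤ ∎
  where
  cancel : ∀ a b → a ℤ.- b ℤ.+ b ≡ a
  cancel = ℤ.solve-∀

-- The exponent -(s + 2) rises to -(s + 1); on coefficients this is the signed Pascal rule solved
-- for its first term.
[1+z]·-negC-suc : ∀ s → [1+z]· (negC (suc s)) ≗ negC s
[1+z]·-negC-suc s zero    = signedC-suc-zero s
[1+z]·-negC-suc s (suc n) rewrite ℕ.+-suc n s = begin
  signedC (suc (suc (n ℕ.+ s))) (suc n) ℤ.+ signedC (suc (n ℕ.+ s)) n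
    ≡⟨ cong (ℤ._+ signedC (suc (n ℕ.+ s)) n) (signedC-suc-suc (suc (n ℕ.+ s)) n) ⟩
  signedC (suc (n ℕ.+ s)) (suc n) ℤ.- signedC (suc (n ℕ.+ s)) n ℤ.+ signedC (suc (n ℕ.+ s)) n
    ≡⟨ cancel (signedC (suc (n ℕ.+ s)) (suc n)) (signedC (suc (n ℕ.+ s)) n) ⟩
  signedC (suc (n ℕ.+ s)) (suc n) ∎
  where
  cancel : ∀ a b → a ℤ.- b ℤ.+ b ≡ a
  cancel = ℤ.solve-∀

+C : ℕ → ℕ → ℤ
+C n k = + (n C k)

+C-suc : ∀ n → +C (suc n) ≗ [1+z]· (+C n)
+C-suc n zero    = refl
+C-suc n (suc k) = begin
  + (suc n C suc k)              ≡⟨ cong +_ (nCk+nC[k+1]≡[n+1]C[k+1] n k) ⟨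
  + (n C k) ℤ.+ + (n C suc k)    ≡⟨ cong +_ (ℕ.+-comm (n C k) (n C suc k)) ⟩
  + (n C suc k) ℤ.+ + (n C k)    ∎

+C-suc-⋆ : ∀ n g → +C (suc n) ⋆ g ≗ +C n ⋆ [1+z]· g
+C-suc-⋆ n g k = trans (⋆-congˡ g k (λ {i} _ → +C-suc n i)) ([1+z]·-⋆ (+C n) g k)

-- Vandermonde with a negative upper index: (1 + z)^(m+s+1) (1 + z)^ -(s+1) = (1 + z)^m.
+C-⋆-negC : ∀ m s → +C (suc (s ℕ.+ m)) ⋆ negC s ≗ +C m
+C-⋆-negC m zero    k = begin
  (+C (suc m) ⋆ negC 0) k           ≡⟨ +C-suc-⋆ m (negC 0) k ⟩
  (+C m ⋆ [1+z]· (negC 0)) k        ≡⟨ ⋆-congʳ (+C m) [1+z]·-negC-zero k ⟩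
  (+C m ⋆ δ) k                      ≡⟨ ⋆-δ (+C m) k ⟩
  +C m k                            ∎
+C-⋆-negC m (suc s) k = begin
  (+C (suc (suc (s ℕ.+ m))) ⋆ negC (suc s)) k
    ≡⟨ +C-suc-⋆ (suc (s ℕ.+ m)) (negC (suc s)) k ⟩
  (+C (suc (s ℕ.+ m)) ⋆ [1+z]· (negC (suc s))) k
    ≡⟨ ⋆-congʳ (+C (suc (s ℕ.+ m))) ([1+z]·-negC-suc s) k ⟩
  (+C (suc (s ℕ.+ m)) ⋆ negC s) k
    ≡⟨ +C-⋆-negC m s k ⟩
  +C m k ∎

-- `BC.hPolynomial` with face numbers and rank as parameters. The two agree definitionally, so the
-- rank `n ∸ 1` can be rewritten as j + s.
hPoly : (ℕ → ℕ) → ℕ → Poly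
hPoly b r = foldr _⊕_ []
  (List.map (λ i → constant (b i) ⊗ z ⊗^ i ⊗ 1-z ⊗^ (r ∸ i)) (upTo (suc r)))

sumTo : (ℕ → ℤ) → ℕ → ℤ
sumTo f zero    = 0ℤ
sumTo f (suc n) = f 0 ℤ.+ sumTo (f ∘ suc) n

sumTo-cong : ∀ {f g} → f ≗ g → ∀ n → sumTo f n ≡ sumTo g n
sumTo-cong f≗g zero    = refl
sumTo-cong f≗g (suc n) = cong₂ ℤ._+_ (f≗g 0) (sumTo-cong (f≗g ∘ suc) n)

sumTo-zero : ∀ f → f ≗ (λ _ → 0ℤ) → ∀ n → sumTo f n ≡ 0ℤ
sumTo-zero f f≗0 zero    = refl
sumTo-zero f f≗0 (suc n) = cong₂ ℤ._+_ (f≗0 0) (sumTo-zero (f ∘ suc) (f≗0 ∘ suc) n)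

coeff-foldr-⊕ : ∀ (p : ℕ → Poly) t n →
  coeff (foldr _⊕_ [] (applyUpTo p t)) n ≡ sumTo (λ i → coeff (p i) n) t
coeff-foldr-⊕ p zero    n = refl
coeff-foldr-⊕ p (suc t) n = trans
  (coeff-⊕ (p 0) (foldr _⊕_ [] (applyUpTo (p ∘ suc) t)) n)
  (cong (ℤ._+_ (coeff (p 0) n)) (coeff-foldr-⊕ (p ∘ suc) t n))

-- Removing the term i = 0 lowers i and j by one and keeps s fixed, which matches the recursion of
-- `_⋆_`. Once j reaches 0, all remaining terms carry a positive power of z and vanish.
sumTo-shift : ∀ (b : ℕ → ℤ) j s →
  sumTo (λ i → b i ℤ.* shift i (signedC (j ℕ.+ s ∸ i)) j) (suc (j ℕ.+ s))
    ≡ (b ⋆ negC s) j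
sumTo-shift b zero    s = begin
  b 0 ℤ.* signedC s 0 ℤ.+ sumTo (λ i → b (suc i) ℤ.* 0ℤ) s
    ≡⟨ cong (ℤ._+_ (b 0 ℤ.* signedC s 0))
            (sumTo-zero _ (λ i → ℤ.*-zeroʳ (b (suc i))) s) ⟩
  b 0 ℤ.* signedC s 0 ℤ.+ 0ℤ
    ≡⟨ ℤ.+-identityʳ _ ⟩
  b 0 ℤ.* signedC s 0 ∎
sumTo-shift b (suc j) s =
  cong (ℤ._+_ (b 0 ℤ.* signedC (suc (j ℕ.+ s)) (suc j))) (sumTo-shift (b ∘ suc) j s)

coeff-hPoly : ∀ b j s → coeff (hPoly b (j ℕ.+ s)) j ≡ ((+_ ∘ b) ⋆ negC s) j
coeff-hPoly b j s = begin
  coeff (hPoly b r) j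
    ≡⟨ cong (λ ps → coeff (foldr _⊕_ [] ps) j) (List.map-upTo term (suc r)) ⟩
  coeff (foldr _⊕_ [] (applyUpTo term (suc r))) j
    ≡⟨ coeff-foldr-⊕ term (suc r) j ⟩
  sumTo (λ i → coeff (term i) j) (suc r)
    ≡⟨ sumTo-cong (λ i → coeff-bz^-⊗ (b i) i (1-z ⊗^ (r ∸ i)) j) (suc r) ⟩
  sumTo (λ i → + b i ℤ.* shift i (signedC (r ∸ i)) j) (suc r)
    ≡⟨ sumTo-shift (+_ ∘ b) j s ⟩
  ((+_ ∘ b) ⋆ negC s) j ∎
  where
  r = j ℕ.+ s
  term : ℕ → Poly
  term i = constant (b i) ⊗ z ⊗^ i ⊗ 1-z ⊗^ (r ∸ i)

-- Up to size j the face numbers are those of a full simplex on E = s + m + 1 vertices. With r = j +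
-- s this makes m = (E - r) + j - 1, that is β + j - 1.
coeff-hPoly-simplex : ∀ b j s m → (∀ {i} → i ℕ.≤ j → b i ≡ suc (s ℕ.+ m) C i) →
  coeff (hPoly b (j ℕ.+ s)) j ≡ + (m C j)
coeff-hPoly-simplex b j s m b≡ = begin
  coeff (hPoly b (j ℕ.+ s)) j              ≡⟨ coeff-hPoly b j s ⟩
  ((+_ ∘ b) ⋆ negC s) j                    ≡⟨ ⋆-congˡ (negC s) j (cong +_ ∘ b≡) ⟩
  (+C (suc (s ℕ.+ m)) ⋆ negC s) j          ≡⟨ +C-⋆-negC m s j ⟩
  + (m C j)                                ∎

-- Small faces

lookup-∷ʳ : ∀ {k} (vs : Vec A k) w (i : Fin (suc k)) →
  (∃[ i′ ] Vec.lookup (vs Vec.∷ʳ w) i ≡ Vec.lookup vs i′ × toℕ i′ ≡ toℕ i)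
  ⊎ (Vec.lookup (vs Vec.∷ʳ w) i ≡ w × toℕ i ≡ k)
lookup-∷ʳ []       w Fin.zero    = inj₂ (refl , refl)
lookup-∷ʳ (v ∷ vs) w Fin.zero    = inj₁ (Fin.zero , refl , refl)
lookup-∷ʳ (v ∷ vs) w (Fin.suc i) with lookup-∷ʳ vs w i
... | inj₁ (i′ , eq , i≡) = inj₁ (Fin.suc i′ , eq , cong suc i≡)
... | inj₂ (eq , i≡k)     = inj₂ (eq , cong suc i≡k)

-- The successor modulo k + 1: here k is the last position of the cycle, not its length.
CyclicSuc : ℕ → ℕ → ℕ → Set
CyclicSuc k i i′ = i′ ≡ suc i ⊎ (i ≡ k × i′ ≡ 0)

-- Returning after two steps would need a cycle of at most two vertices; the bound 2 ≤ k says that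
-- there are at least three.
¬CyclicSuc-2-periodic : ∀ {k i i′} → 2 ℕ.≤ k → CyclicSuc k i i′ → ¬ CyclicSuc k i′ i
¬CyclicSuc-2-periodic 2≤k (inj₁ refl) (inj₁ i≡)         = ℕ.m≢1+n+m _ {1} i≡
¬CyclicSuc-2-periodic 2≤k (inj₁ refl) (inj₂ (refl , refl)) = ℕ.1+n≰n 2≤k
¬CyclicSuc-2-periodic 2≤k (inj₂ (refl , refl)) (inj₁ refl) = ℕ.1+n≰n 2≤k
¬CyclicSuc-2-periodic ()  (inj₂ (refl , refl)) (inj₂ (refl , i≡))

∣p∣≤1+∣p-x∣ : ∀ {n} (p : Subset n) x → ∣ p ∣ ℕ.≤ suc ∣ p - x ∣
∣p∣≤1+∣p-x∣ (inside  ∷ p) Fin.zero    = s≤s (ℕ.≤-reflexive (cong ∣_∣ (sym (p─⊥≡p p))))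
∣p∣≤1+∣p-x∣ (outside ∷ p) Fin.zero    = ℕ.m≤n⇒m≤1+n (ℕ.≤-reflexive (cong ∣_∣ (sym (p─⊥≡p p))))
∣p∣≤1+∣p-x∣ (inside  ∷ p) (Fin.suc x) = s≤s (∣p∣≤1+∣p-x∣ p x)
∣p∣≤1+∣p-x∣ (outside ∷ p) (Fin.suc x) = ∣p∣≤1+∣p-x∣ p x

injective⇒≤∣∣ : ∀ {n k} (p : Subset n) (f : Fin k → Fin n) →
  (∀ {i j} → f i ≡ f j → i ≡ j) → (∀ i → f i ∈ p) → k ℕ.≤ ∣ p ∣
injective⇒≤∣∣ {k = zero}  p f inj f∈p = z≤n
injective⇒≤∣∣ {k = suc k} p f inj f∈p = ℕ.≤-trans
  (s≤s (injective⇒≤∣∣ (p - f Fin.zero) (f ∘ Fin.suc) (Fin.suc-injective ∘ inj)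
    λ i → x∈p∧x≢y⇒x∈p-y (f∈p (Fin.suc i)) (Fin.0≢1+n ∘ sym ∘ inj)))
  (x∈p⇒∣p-x∣<∣p∣ (f∈p Fin.zero))

length-filter-map : {P : Pred B p} (P? : Decidable₁ P) (f : A → B) → ∀ xs →
  List.length (List.filter P? (List.map f xs)) ≡ List.length (List.filter (P? ∘ f) xs)
length-filter-map P? f []       = refl
length-filter-map P? f (x ∷ xs) with does (P? (f x))
... | true  = cong suc (length-filter-map P? f xs)
... | false = length-filter-map P? f xs

length-subsets-of-size : ∀ m i →
  List.length (List.filter (λ S → ∣ S ∣ ℕ.≟ i) (subsets m)) ≡ m C i
length-subsets-of-size zero    zero    = refl
length-subsets-of-size zero    (suc i) = sym (k>n⇒nCk≡0 {0} {suc i} (s≤s z≤n))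
length-subsets-of-size (suc m) i       = begin
  List.length (List.filter size? (outs List.++ ins))
    ≡⟨ cong List.length (List.filter-++ size? outs ins) ⟩
  List.length (List.filter size? outs List.++ List.filter size? ins)
    ≡⟨ List.length-++ (List.filter size? outs) ⟩
  List.length (List.filter size? outs) ℕ.+ List.length (List.filter size? ins)
    ≡⟨ cong₂ ℕ._+_ (length-filter-map size? (outside ∷_) (subsets m))
                   (length-filter-map size? (inside ∷_) (subsets m)) ⟩
  List.length (List.filter (λ S → ∣ S ∣ ℕ.≟ i) (subsets m))
    ℕ.+ List.length (List.filter (λ S → suc ∣ S ∣ ℕ.≟ i) (subsets m))
    ≡⟨ cong₂ ℕ._+_ (length-subsets-of-size m i) (with-element i) ⟩
  m C i ℕ.+ pred-C i
    ≡⟨ pascal i ⟩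
  suc m C i ∎
  where
  outs = List.map (outside ∷_) (subsets m)
  ins  = List.map (inside ∷_) (subsets m)
  size? : Decidable₁ (λ (S : Subset (suc m)) → ∣ S ∣ ≡ i)
  size? S = ∣ S ∣ ℕ.≟ i
  -- C(m, i - 1), with value 0 at i = 0: a set that contains the new element is nonempty.
  pred-C : ℕ → ℕ
  pred-C zero    = 0
  pred-C (suc i) = m C i
  with-element : ∀ i →
    List.length (List.filter (λ S → suc ∣ S ∣ ℕ.≟ i) (subsets m)) ≡ pred-C i
  with-element zero    = cong List.length
    (List.filter-none (λ S → suc ∣ S ∣ ℕ.≟ 0) (LAll.universal (λ _ ()) (subsets m)))
  with-element (suc i) = trans
    (cong List.length (List.filter-≐ (λ S → suc ∣ S ∣ ℕ.≟ suc i) (λ S → ∣ S ∣ ℕ.≟ i)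
      (ℕ.suc-injective , cong suc) (subsets m)))
    (length-subsets-of-size m i)
  pascal : ∀ i → m C i ℕ.+ pred-C i ≡ suc m C i
  pascal zero    = refl
  pascal (suc i) = trans (ℕ.+-comm (m C suc i) (m C i)) (nCk+nC[k+1]≡[n+1]C[k+1] m i)

module _ {n : ℕ} (G : Graph n) where
  open Graph G

  ordered-edge : ∀ {u v} → u Fin.< v → u ~ v → ∃[ e ] ends G e ≡ (u , v)
  ordered-edge {u} {v} u<v u~v = LAny.index uv∈ , sym (LAny.lookup-index uv∈)
    where
    uv∈ = ∈-filter⁺ _ (∈-cartesianProduct⁺ (∈-allFin u) (∈-allFin v)) (u<v , u~v)

  ~⇒joined : ∀ {u v} → u ~ v → ∃[ e ] Joins G e (u , v)
  ~⇒joined {u} {v} u~v with Fin.<-cmp u v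
  ... | tri< u<v _ _ = let (e , eq) = ordered-edge u<v u~v in e , inj₁ eq
  ... | tri≈ _ u≡v _ = contradiction u~v (~-irr u≡v)
  ... | tri> _ _ v<u = let (e , eq) = ordered-edge v<u (~-sym u~v) in e , inj₂ eq

  joins-unique : ∀ {e u v x y} → Joins G e (u , v) → Joins G e (x , y) →
    (u ≡ x × v ≡ y) ⊎ (u ≡ y × v ≡ x)
  joins-unique (inj₁ p) (inj₁ q) with refl ← trans (sym p) q = inj₁ (refl , refl)
  joins-unique (inj₁ p) (inj₂ q) with refl ← trans (sym p) q = inj₂ (refl , refl)
  joins-unique (inj₂ p) (inj₁ q) with refl ← trans (sym p) q = inj₂ (refl , refl)
  joins-unique (inj₂ p) (inj₂ q) with refl ← trans (sym p) q = inj₁ (refl , refl)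

  joins⇒∈cycleEdges : ∀ {k} (vs : Vec (Fin n) k) e i →
    Joins G e (Vec.lookup (steps G vs) i) → e ∈ cycleEdges G vs
  joins⇒∈cycleEdges vs e i joins = Vec.lookup⇒[]= e (cycleEdges G vs)
    (trans (Vec.lookup∘tabulate _ e)
           (dec-true (Any.any? (joins? G e) (steps G vs)) (found (steps G vs) i joins)))
    where
    found : ∀ {k} (ps : Vec (Fin n × Fin n) k) i →
      Joins G e (Vec.lookup ps i) → Any.Any (Joins G e) ps
    found (p ∷ ps) Fin.zero    j = Any.here j
    found (p ∷ ps) (Fin.suc i) j = Any.there (found ps i j)

  lookup-steps : ∀ {k} (vs : Vec (Fin n) (suc k)) i → ∃[ i′ ]
    Vec.lookup (steps G vs) i ≡ (Vec.lookup vs i , Vec.lookup vs i′)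
      × CyclicSuc k (toℕ i) (toℕ i′)
  lookup-steps (v ∷ vs) i
    with lookup-∷ʳ vs v i | Vec.lookup-zip i (v ∷ vs) (vs Vec.∷ʳ v)
  ... | inj₁ (i′ , eq , i≡) | zip≡ =
    Fin.suc i′ , trans zip≡ (cong (Vec.lookup (v ∷ vs) i ,_) eq) , inj₁ (cong suc i≡)
  ... | inj₂ (eq , i≡k)     | zip≡ =
    Fin.zero , trans zip≡ (cong (Vec.lookup (v ∷ vs) i ,_) eq) , inj₂ (i≡k , refl)

  -- Each step of the cycle picks an edge, and distinct steps pick distinct ones. If two steps share
  -- an edge, either they start at the same vertex, so their positions agree, or they traverse it in
  -- opposite directions, so each position is the cyclic successor of the other.
  length≤∣cycleEdges∣ : ∀ {k} (vs : Vec (Fin n) k) → IsCycle G vs →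
    k ℕ.≤ ∣ cycleEdges G vs ∣
  length≤∣cycleEdges∣ {suc k} vs (s≤s 2≤k , unique , adjacent) =
    injective⇒≤∣∣ (cycleEdges G vs) (proj₁ ∘ edge) edge-injective
      λ i → joins⇒∈cycleEdges vs (proj₁ (edge i)) i (proj₂ (edge i))
    where
    edge : ∀ i → ∃[ e ] Joins G e (Vec.lookup (steps G vs) i)
    edge i = ~⇒joined (All.lookup adjacent (Vec.∈-lookup i (steps G vs)))

    vs-injective : ∀ {i j} → Vec.lookup vs i ≡ Vec.lookup vs j → i ≡ j
    vs-injective = lookup-injective unique _ _

    edge-injective : ∀ {i j} → proj₁ (edge i) ≡ proj₁ (edge j) → i ≡ j
    edge-injective {i} {j} same
      with lookup-steps vs i | lookup-steps vs j
    ... | i′ , i-eq , i-suc | j′ , j-eq , j-suc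
      with joins-unique (subst (Joins G (proj₁ (edge i))) i-eq (proj₂ (edge i)))
                        (subst (λ e → Joins G e _) (sym same)
                          (subst (Joins G (proj₁ (edge j))) j-eq (proj₂ (edge j))))
    ... | inj₁ (i≡j , _)    = vs-injective i≡j
    ... | inj₂ (i≡j′ , i′≡j) with refl ← vs-injective {i} {j′} i≡j′ | refl ← vs-injective {i′} {j} i′≡j =
      contradiction j-suc (¬CyclicSuc-2-periodic 2≤k i-suc)

module _ {n : ℕ} (G : Graph n) (order : EdgeOrder G) {g : ℕ} (girth : IsGirth G g) where
  open BC G order

  girth≤1+∣brokenCircuit∣ : ∀ {B} → IsBrokenCircuit B → g ℕ.≤ suc ∣ B ∣
  girth≤1+∣brokenCircuit∣ (k , vs , cycle , e , _ , refl) = R.begin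
    g                              R.≤⟨ proj₂ girth vs cycle ⟩
    k                              R.≤⟨ length≤∣cycleEdges∣ G vs cycle ⟩
    ∣ cycleEdges G vs ∣            R.≤⟨ ∣p∣≤1+∣p-x∣ (cycleEdges G vs) e ⟩
    suc ∣ cycleEdges G vs - e ∣    R.∎
    where module R = ℕ.≤-Reasoning

  small⇒face : ∀ {S} → suc ∣ S ∣ ℕ.< g → IsFace S
  small⇒face small (B , broken , B⊆S) = ℕ.<⇒≱ small
    (ℕ.≤-trans (girth≤1+∣brokenCircuit∣ broken) (s≤s (p⊆q⇒∣p∣≤∣q∣ B⊆S)))

  faceCount-small : ∀ {i} → suc i ℕ.< g → faceCount i ≡ edgeCount G C i
  faceCount-small {i} 1+i<g = trans
    (cong List.length (List.filter-≐ _ (λ S → ∣ S ∣ ℕ.≟ i)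
      (proj₂ , λ eq → small⇒face (subst (λ m → suc m ℕ.< g) (sym eq) 1+i<g) , eq) (subsets (edgeCount G))))
    (length-subsets-of-size (edgeCount G) i)

-- The handshake lemma

⟦_⟧ : Dec A → ℕ
⟦ a? ⟧ = if does a? then 1 else 0

length-filter-tabulate : {P : Pred A p} (P? : Decidable₁ P) → ∀ {m} (f : Fin m → A) →
  List.length (List.filter P? (List.tabulate f)) ≡ sum (λ i → ⟦ P? (f i) ⟧)
length-filter-tabulate P? {zero}  f = refl
length-filter-tabulate P? {suc m} f with does (P? (f Fin.zero))
... | true  = cong suc (length-filter-tabulate P? (f ∘ Fin.suc))
... | false = length-filter-tabulate P? (f ∘ Fin.suc)

length-filter-product : {P : Pred (A × B) p} (P? : Decidable₁ P) →
  ∀ {m k} (f : Fin m → A) (g : Fin k → B) →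
  List.length (List.filter P? (List.cartesianProduct (List.tabulate f) (List.tabulate g)))
    ≡ sum (λ i → sum (λ j → ⟦ P? (f i , g j) ⟧))
length-filter-product P? {zero}  f g = refl
length-filter-product P? {suc m} f g = begin
  List.length (List.filter P? (row List.++ rows))
    ≡⟨ cong List.length (List.filter-++ P? row rows) ⟩
  List.length (List.filter P? row List.++ List.filter P? rows)
    ≡⟨ List.length-++ (List.filter P? row) ⟩
  List.length (List.filter P? row) ℕ.+ List.length (List.filter P? rows)
    ≡⟨ cong₂ ℕ._+_
         (trans (length-filter-map P? (f Fin.zero ,_) (List.tabulate g))
                (length-filter-tabulate (λ y → P? (f Fin.zero , y)) g))
         (length-filter-product P? (f ∘ Fin.suc) g) ⟩
  sum (λ i → sum (λ j → ⟦ P? (f i , g j) ⟧)) ∎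
  where
  row  = List.map (f Fin.zero ,_) (List.tabulate g)
  rows = List.cartesianProduct (List.tabulate (f ∘ Fin.suc)) (List.tabulate g)

sum-const : ∀ n c → sum {n} (λ _ → c) ≡ n ℕ.* c
sum-const zero    c = refl
sum-const (suc n) c = cong (c ℕ.+_) (sum-const n c)

module _ {n : ℕ} (G : Graph n) where
  open Graph G

  private
    up : Fin n → Fin n → ℕ
    up u v = ⟦ (u Fin.<? v) ×-dec (u ~? v) ⟧

    up-up : ∀ u v → up u v ℕ.+ up v u ≡ ⟦ u ~? v ⟧
    up-up u v with Fin.<-cmp u v
    ... | tri< u<v _ v≮u
      rewrite dec-true (u Fin.<? v) u<v | dec-false (v Fin.<? u) v≮u = ℕ.+-identityʳ _
    ... | tri≈ u≮v u≡v v≮u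
      rewrite dec-false (u Fin.<? v) u≮v | dec-false (v Fin.<? u) v≮u
            | dec-false (u ~? v) (~-irr u≡v) = refl
    ... | tri> u≮v _ v<u
      rewrite dec-false (u Fin.<? v) u≮v | dec-true (v Fin.<? u) v<u
      -- The left side has decided v ~ u and the right side u ~ v; symmetry excludes different
      -- answers.
      with u ~? v | v ~? u
    ... | yes _   | yes _   = refl
    ... | no  _   | no  _   = refl
    ... | yes u~v | no  v≁u = contradiction (~-sym u~v) v≁u
    ... | no  u≁v | yes v~u = contradiction (~-sym v~u) u≁v

  edgeCount-sum : edgeCount G ≡ sum (λ u → sum (up u))
  edgeCount-sum = length-filter-product (λ (u , v) → (u Fin.<? v) ×-dec (u ~? v)) id id

  -- Double counting: every adjacency indicator splits into its two orientations, and exchanging the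
  -- order of summation shows that each orientation contributes the number of edges.
  handshake : sum (degree G) ≡ edgeCount G ℕ.+ edgeCount G
  handshake = begin
    sum (degree G)
      ≡⟨ sum-cong-≗ (λ u → length-filter-tabulate (u ~?_) id) ⟩
    sum (λ u → sum (λ v → ⟦ u ~? v ⟧))
      ≡⟨ sum-cong-≗ (λ u → sum-cong-≗ (up-up u)) ⟨
    sum (λ u → sum (λ v → up u v ℕ.+ up v u))
      ≡⟨ sum-cong-≗ (λ u → ∑-distrib-+ (up u) (λ v → up v u)) ⟩
    sum (λ u → sum (up u) ℕ.+ sum (λ v → up v u))
      ≡⟨ ∑-distrib-+ (λ u → sum (up u)) (λ u → sum (λ v → up v u)) ⟩
    sum (λ u → sum (up u)) ℕ.+ sum (λ u → sum (λ v → up v u))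
      ≡⟨ cong (sum (λ u → sum (up u)) ℕ.+_) (∑-comm (λ u v → up v u)) ⟩
    sum (λ u → sum (up u)) ℕ.+ sum (λ u → sum (up u))
      ≡⟨ cong₂ ℕ._+_ edgeCount-sum edgeCount-sum ⟨
    edgeCount G ℕ.+ edgeCount G ∎

  regular⇒edgeCount : ∀ {d} → Regular G d → n ℕ.* d ≡ 2 ℕ.* edgeCount G
  regular⇒edgeCount {d} regular = begin
    n ℕ.* d                           ≡⟨ sum-const n d ⟨
    sum {n} (λ _ → d)                 ≡⟨ sum-cong-≗ regular ⟨
    sum (degree G)                    ≡⟨ handshake ⟩
    edgeCount G ℕ.+ edgeCount G       ≡⟨ cong (edgeCount G ℕ.+_) (ℕ.+-identityʳ _) ⟨
    2 ℕ.* edgeCount G                 ∎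

  module _ {d : ℕ} (3≤d : 3 ℕ.≤ d) (regular : Regular G d) where

    -- This is x = β - 1. The subtraction is exact by `n≤E`, and in terms of x the truncated `∸ 1`
    -- in the binomial coefficient disappears.
    excess : ℕ
    excess = edgeCount G ∸ n

    private
      n*3≤2*E : n ℕ.* 3 ℕ.≤ 2 ℕ.* edgeCount G
      n*3≤2*E = subst (n ℕ.* 3 ℕ.≤_) (regular⇒edgeCount regular) (ℕ.*-monoʳ-≤ n 3≤d)

      n≤E : n ℕ.≤ edgeCount G
      n≤E = ℕ.*-cancelˡ-≤ 2 (ℕ.≤-trans (ℕ.≤-reflexive (ℕ.*-comm 2 n))
        (ℕ.≤-trans (ℕ.*-monoʳ-≤ n (ℕ.n≤1+n 2)) n*3≤2*E))

    n+excess : n ℕ.+ excess ≡ edgeCount G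
    n+excess = ℕ.m+[n∸m]≡n n≤E

    cycleRank-excess : cycleRank G ≡ excess ℕ.+ 1
    cycleRank-excess = begin
      edgeCount G ℕ.+ 1 ∸ n            ≡⟨ cong (λ e → e ℕ.+ 1 ∸ n) n+excess ⟨
      n ℕ.+ excess ℕ.+ 1 ∸ n           ≡⟨ cong (_∸ n) (ℕ.+-assoc n excess 1) ⟩
      n ℕ.+ (excess ℕ.+ 1) ∸ n         ≡⟨ ℕ.m+n∸m≡n n (excess ℕ.+ 1) ⟩
      excess ℕ.+ 1                     ∎

    cycleRank+j∸1 : ∀ j → cycleRank G ℕ.+ j ∸ 1 ≡ excess ℕ.+ j
    cycleRank+j∸1 j = begin
      cycleRank G ℕ.+ j ∸ 1            ≡⟨ cong (λ β → β ℕ.+ j ∸ 1) cycleRank-excess ⟩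
      excess ℕ.+ 1 ℕ.+ j ∸ 1           ≡⟨ cong (λ β → β ℕ.+ j ∸ 1) (ℕ.+-comm excess 1) ⟩
      excess ℕ.+ j                     ∎

    2*n+2*excess : 2 ℕ.* n ℕ.+ 2 ℕ.* excess ≡ n ℕ.* d
    2*n+2*excess = begin
      2 ℕ.* n ℕ.+ 2 ℕ.* excess         ≡⟨ ℕ.*-distribˡ-+ 2 n excess ⟨
      2 ℕ.* (n ℕ.+ excess)             ≡⟨ cong (2 ℕ.*_) n+excess ⟩
      2 ℕ.* edgeCount G                ≡⟨ regular⇒edgeCount regular ⟨
      n ℕ.* d                          ∎

    -- From nd ≥ 3n at least n remains after removing 2n. Hence x grows with the number of vertices,
    -- as the asymptotics require.
    n≤2*excess : n ℕ.≤ 2 ℕ.* excess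
    n≤2*excess = ℕ.+-cancelˡ-≤ (2 ℕ.* n) n (2 ℕ.* excess)
      (subst₂ ℕ._≤_ (3n n) (trans (sym (regular⇒edgeCount regular)) (sym 2*n+2*excess)) n*3≤2*E)
      where
      3n : ∀ n → n ℕ.* 3 ≡ 2 ℕ.* n ℕ.+ n
      3n = ℕ.solve-∀

-- Asymptotics of binomial coefficients

-- The product (x + 1) ⋯ (x + j), which begins at x + 1 and not at x; it equals j! C(x + j, j).
rising : ℕ → ℕ → ℕ
rising x zero    = 1
rising x (suc j) = (x ℕ.+ suc j) ℕ.* rising x j

rising-*-! : ∀ x j → rising x j ℕ.* x ! ≡ (x ℕ.+ j) !
rising-*-! x zero    = trans (ℕ.*-identityˡ (x !)) (cong _! (sym (ℕ.+-identityʳ x)))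
rising-*-! x (suc j) rewrite ℕ.+-suc x j =
  trans (ℕ.*-assoc (suc (x ℕ.+ j)) (rising x j) (x !)) (cong (suc (x ℕ.+ j) ℕ.*_) (rising-*-! x j))

C-*-!-*-! : ∀ x j → ((x ℕ.+ j) C j) ℕ.* (j ! ℕ.* x !) ≡ (x ℕ.+ j) !
C-*-!-*-! x j = subst (λ y → ((x ℕ.+ j) C j) ℕ.* (j ! ℕ.* y !) ≡ (x ℕ.+ j) !) (ℕ.m+n∸n≡m x j) (begin
  ((x ℕ.+ j) C j) ℕ.* (j ! ℕ.* (x ℕ.+ j ∸ j) !)
    ≡⟨ cong (ℕ._* (j ! ℕ.* (x ℕ.+ j ∸ j) !)) (nCk≡n!/k![n-k]! j≤) ⟩
  (x ℕ.+ j) ! ℕ./ (j ! ℕ.* (x ℕ.+ j ∸ j) !) ℕ.* (j ! ℕ.* (x ℕ.+ j ∸ j) !)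
    ≡⟨ ℕ.m/n*n≡m (k![n∸k]!∣n! j≤) ⟩
  (x ℕ.+ j) ! ∎)
  where
  j≤ : j ℕ.≤ x ℕ.+ j
  j≤ = ℕ.m≤n+m j x
  instance _ = j ℕ.!* (x ℕ.+ j ∸ j) !≢0

C-*-! : ∀ x j → ((x ℕ.+ j) C j) ℕ.* j ! ≡ rising x j
C-*-! x j = ℕ.*-cancelʳ-≡ _ _ (x !) {{x ℕ.!≢0}} (begin
  ((x ℕ.+ j) C j) ℕ.* j ! ℕ.* x !       ≡⟨ ℕ.*-assoc ((x ℕ.+ j) C j) (j !) (x !) ⟩
  ((x ℕ.+ j) C j) ℕ.* (j ! ℕ.* x !)     ≡⟨ C-*-!-*-! x j ⟩
  (x ℕ.+ j) !                           ≡⟨ rising-*-! x j ⟨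
  rising x j ℕ.* x !                    ∎)

^≤rising : ∀ x j → x ℕ.^ j ℕ.≤ rising x j
^≤rising x zero    = ℕ.≤-refl
^≤rising x (suc j) = ℕ.*-mono-≤ (ℕ.m≤m+n x (suc j)) (^≤rising x j)

-- The recursion comes from (x + l)(x + K) = x(x + l + K) + lK ≤ x(x + l + K + lK) with l = j + 1.
-- In closed form it is (j + 1)! - 1, the sum of the coefficients of (x + 1) ⋯ (x + j) below the
-- leading one.
risingError : ℕ → ℕ
risingError zero    = 0
risingError (suc j) = suc j ℕ.+ risingError j ℕ.+ suc j ℕ.* risingError j

-- risingError j collects the lower-order coefficients, x ≥ 1 absorbing their powers of x.
*-rising≤ : ∀ x j → 1 ℕ.≤ x → x ℕ.* rising x j ℕ.≤ (x ℕ.+ risingError j) ℕ.* x ℕ.^ j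
*-rising≤ x zero    1≤x = ℕ.≤-reflexive (cong (ℕ._* 1) (sym (ℕ.+-identityʳ x)))
*-rising≤ x (suc j) 1≤x = R.begin
  x ℕ.* ((x ℕ.+ suc j) ℕ.* rising x j)
    R.≡⟨ swap x (x ℕ.+ suc j) (rising x j) ⟩
  (x ℕ.+ suc j) ℕ.* (x ℕ.* rising x j)
    R.≤⟨ ℕ.*-monoʳ-≤ (x ℕ.+ suc j) (*-rising≤ x j 1≤x) ⟩
  (x ℕ.+ suc j) ℕ.* ((x ℕ.+ K) ℕ.* x ℕ.^ j)
    R.≡⟨ expand x (suc j) K (x ℕ.^ j) ⟩
  -- The factor 1 is kept so that 1 ≤ x can replace it by x.
  (x ℕ.* (x ℕ.+ (suc j ℕ.+ K)) ℕ.+ suc j ℕ.* K ℕ.* 1) ℕ.* x ℕ.^ j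
    R.≤⟨ ℕ.*-monoˡ-≤ (x ℕ.^ j) (ℕ.+-monoʳ-≤ (x ℕ.* (x ℕ.+ (suc j ℕ.+ K)))
         (ℕ.*-monoʳ-≤ (suc j ℕ.* K) 1≤x)) ⟩
  (x ℕ.* (x ℕ.+ (suc j ℕ.+ K)) ℕ.+ suc j ℕ.* K ℕ.* x) ℕ.* x ℕ.^ j
    R.≡⟨ collect x (suc j) K (x ℕ.^ j) ⟩
  (x ℕ.+ (suc j ℕ.+ K ℕ.+ suc j ℕ.* K)) ℕ.* (x ℕ.* x ℕ.^ j) R.∎
  where
  module R = ℕ.≤-Reasoning
  K = risingError j
  swap : ∀ x y r → x ℕ.* (y ℕ.* r) ≡ y ℕ.* (x ℕ.* r)
  swap = ℕ.solve-∀
  expand : ∀ x l K p → (x ℕ.+ l) ℕ.* ((x ℕ.+ K) ℕ.* p)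
                     ≡ (x ℕ.* (x ℕ.+ (l ℕ.+ K)) ℕ.+ l ℕ.* K ℕ.* 1) ℕ.* p
  expand = ℕ.solve-∀
  collect : ∀ x l K p → (x ℕ.* (x ℕ.+ (l ℕ.+ K)) ℕ.+ l ℕ.* K ℕ.* x) ℕ.* p
                      ≡ (x ℕ.+ (l ℕ.+ K ℕ.+ l ℕ.* K)) ℕ.* (x ℕ.* p)
  collect = ℕ.solve-∀

-- Integers and naturals inside ℚ

i/1≡mkℚ : ∀ i → i / 1 ≡ mkℚ i 0 (ℕ.sym (ℕ.1-coprimeTo ℤ.∣ i ∣))
i/1≡mkℚ i = ℚ.fromℚᵘ-toℚᵘ (mkℚ i 0 _)

-- For variable i the fraction `i / 1` is stuck on a gcd; rewriting it as an explicit fraction with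
-- denominator 1 lets addition compute.
/1-homo-+ : ∀ i j → (i ℤ.+ j) / 1 ≡ i / 1 ℚ.+ j / 1
/1-homo-+ i j rewrite i/1≡mkℚ i | i/1≡mkℚ j =
  cong (_/ 1) (sym (cong₂ ℤ._+_ (ℤ.*-identityʳ i) (ℤ.*-identityʳ j)))

/1-homo-* : ∀ i j → (i ℤ.* j) / 1 ≡ i / 1 ℚ.* (j / 1)
/1-homo-* i j rewrite i/1≡mkℚ i | i/1≡mkℚ j = refl

/2≡/1*½ : ∀ i → i / 2 ≡ i / 1 ℚ.* ½
/2≡/1*½ i rewrite i/1≡mkℚ i = cong (_/ 2) (sym (ℤ.*-identityʳ i))

fromℕ-homo-+ : ∀ m n → fromℕ (m ℕ.+ n) ≡ fromℕ m ℚ.+ fromℕ n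
fromℕ-homo-+ m n = /1-homo-+ (+ m) (+ n)

fromℕ-homo-* : ∀ m n → fromℕ (m ℕ.* n) ≡ fromℕ m ℚ.* fromℕ n
fromℕ-homo-* m n = trans (cong (_/ 1) (ℤ.pos-* m n)) (/1-homo-* (+ m) (+ n))

fromℕ-homo-^ : ∀ m n → fromℕ (m ℕ.^ n) ≡ fromℕ m ^ℚ n
fromℕ-homo-^ m zero    = refl
fromℕ-homo-^ m (suc n) =
  trans (fromℕ-homo-* m (m ℕ.^ n)) (cong (fromℕ m ℚ.*_) (fromℕ-homo-^ m n))

fromℕ-mono-≤ : ∀ {m n} → m ℕ.≤ n → fromℕ m ℚ.≤ fromℕ n
fromℕ-mono-≤ {m} {n} m≤n rewrite i/1≡mkℚ (+ m) | i/1≡mkℚ (+ n) =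
  *≤* (ℤ.*-monoʳ-≤-nonNeg (+ 1) (ℤ.+≤+ m≤n))

fromℕ-mono-< : ∀ {m n} → m ℕ.< n → fromℕ m ℚ.< fromℕ n
fromℕ-mono-< {m} {n} m<n rewrite i/1≡mkℚ (+ m) | i/1≡mkℚ (+ n) =
  *<* (ℤ.*-monoʳ-<-pos (+ 1) (ℤ.+<+ m<n))

fromℕ-pos : ∀ n .{{_ : ℕ.NonZero n}} → ℚ.Positive (fromℕ n)
fromℕ-pos (suc n) = ℚ.normalize-pos (suc n) 1

fromℕ-*-inverse : ∀ n .{{_ : ℕ.NonZero n}} → fromℕ n ℚ.* (1ℤ / n) ≡ 1ℚ
fromℕ-*-inverse (suc n) = trans
  (cong₂ ℚ._*_ (i/1≡mkℚ (+ suc n)) (ℚ.normalize-coprime (ℕ.1-coprimeTo (suc n))))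
  (ℚ.*-inverseʳ (mkℚ (+ suc n) 0 (ℕ.sym (ℕ.1-coprimeTo (suc n)))))

-- The absolute value of the numerator suffices, as denominators are at least 1.
archimedean : ∀ q → ∃[ t ] q ℚ.≤ fromℕ t
archimedean q@(mkℚ i d _) = ℤ.∣ i ∣ , subst (q ℚ.≤_) (sym (i/1≡mkℚ (+ ℤ.∣ i ∣))) (*≤* (bound i))
  where
  bound : ∀ i → i ℤ.* + 1 ℤ.≤ + ℤ.∣ i ∣ ℤ.* + suc d
  bound (+ n)    = subst₂ ℤ._≤_ (ℤ.pos-* n 1) (ℤ.pos-* n (suc d)) (ℤ.+≤+ (ℕ.*-monoʳ-≤ n (s≤s z≤n)))
  bound -[1+ n ] = ℤ.-≤+

-- Relative error of the binomial coefficient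

RatioWithin : ℚ → ℚ → ℚ → Set
RatioWithin ε a b = Σ[ b≢0 ∈ ℚ.NonZero b ] ℚ.∣ _÷_ a b {{b≢0}} ℚ.- 1ℚ ∣ ℚ.< ε

∣÷-1∣< : ∀ {a b ε} (b>0 : ℚ.Positive b) → b ℚ.≤ a → a ℚ.< b ℚ.+ ε ℚ.* b →
  ℚ.∣ _÷_ a b {{ℚ.pos⇒nonZero b {{b>0}}}} ℚ.- 1ℚ ∣ ℚ.< ε
∣÷-1∣< {a} {b} {ε} b>0 b≤a a< = R.begin-strict
  ℚ.∣ a ℚ.* 1/b ℚ.- 1ℚ ∣              R.≡⟨ cong (λ q → ℚ.∣ a ℚ.* 1/b ℚ.- q ∣) (ℚ.*-inverseʳ b) ⟨
  ℚ.∣ a ℚ.* 1/b ℚ.- b ℚ.* 1/b ∣       R.≡⟨ cong ℚ.∣_∣ (factor a b 1/b) ⟩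
  ℚ.∣ (a ℚ.- b) ℚ.* 1/b ∣             R.≡⟨ ℚ.0≤p⇒∣p∣≡p nonneg ⟩
  (a ℚ.- b) ℚ.* 1/b                   R.<⟨ ℚ.*-monoˡ-<-pos 1/b (ℚ.+-monoˡ-< (ℚ.- b) a<) ⟩
  (b ℚ.+ ε ℚ.* b ℚ.- b) ℚ.* 1/b       R.≡⟨ simplify b ε 1/b ⟩
  ε ℚ.* (b ℚ.* 1/b)                   R.≡⟨ cong (ε ℚ.*_) (ℚ.*-inverseʳ b) ⟩
  ε ℚ.* 1ℚ                            R.≡⟨ ℚ.*-identityʳ ε ⟩
  ε                                   R.∎
  where
  module R = ℚ.≤-Reasoning
  open +-*-Solver
  instance
    _ = b>0
    _ = ℚ.pos⇒nonZero b
  1/b = ℚ.1/ b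
  instance
    _ = ℚ.1/pos⇒pos b
    _ = ℚ.pos⇒nonNeg 1/b
  factor : ∀ a b c → a ℚ.* c ℚ.- b ℚ.* c ≡ (a ℚ.- b) ℚ.* c
  factor = solve 3 (λ a b c → a :* c :- b :* c := (a :- b) :* c) refl
  simplify : ∀ b ε c → (b ℚ.+ ε ℚ.* b ℚ.- b) ℚ.* c ≡ ε ℚ.* (b ℚ.* c)
  simplify = solve 3 (λ b ε c → (b :+ ε :* b :- b) :* c := ε :* (b :* c)) refl
  nonneg : 0ℚ ℚ.≤ (a ℚ.- b) ℚ.* 1/b
  nonneg = subst₂ ℚ._≤_ (trans (cong (ℚ._* 1/b) (ℚ.+-inverseʳ b)) (ℚ.*-zeroˡ 1/b)) refl
    (ℚ.*-monoʳ-≤-nonNeg 1/b (ℚ.+-monoˡ-≤ (ℚ.- b) b≤a))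

-- The relative error of C(x + j, j) ~ xʲ / j! is at most risingError j / x.
C-close : ∀ x j ε → 1 ℕ.≤ x → fromℕ (risingError j) ℚ.< ε ℚ.* fromℕ x →
  RatioWithin ε (fromℕ ((x ℕ.+ j) C j)) (_/_ 1ℤ (j !) {{j ℕ.!≢0}} ℚ.* fromℕ x ^ℚ j)
C-close x j ε 1≤x K< = ℚ.pos⇒nonZero b , ∣÷-1∣< {a} {b} {ε} b>0 b≤a a<
  where
  open +-*-Solver
  instance
    _ = ℕ.>-nonZero 1≤x
    j!≢0 : ℕ.NonZero (j !)
    j!≢0 = j ℕ.!≢0
    _ = ℕ.m^n≢0 x j
  a b F X P : ℚ
  a = fromℕ ((x ℕ.+ j) C j)
  b = 1ℤ / (j !) ℚ.* fromℕ x ^ℚ j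
  F = fromℕ (j !)
  X = fromℕ x
  P = fromℕ (x ℕ.^ j)
  instance
    _ = fromℕ-pos (j !)
    _ = fromℕ-pos x
    P>0 : ℚ.Positive P
    P>0 = fromℕ-pos (x ℕ.^ j)
    1/F>0 : ℚ.Positive (1ℤ / (j !))
    1/F>0 = ℚ.normalize-pos 1 (j !)
    b>0 : ℚ.Positive b
    b>0 = subst (λ p → ℚ.Positive (1ℤ / (j !) ℚ.* p)) (fromℕ-homo-^ x j)
            (ℚ.pos*pos⇒pos (1ℤ / (j !)) P)
    _ = ℚ.pos*pos⇒pos F X
  F*b : F ℚ.* b ≡ P
  F*b = begin
    F ℚ.* (1ℤ / (j !) ℚ.* X ^ℚ j)      ≡⟨ ℚ.*-assoc F (1ℤ / (j !)) (X ^ℚ j) ⟨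
    F ℚ.* (1ℤ / (j !)) ℚ.* X ^ℚ j      ≡⟨ cong₂ ℚ._*_ (fromℕ-*-inverse (j !)) (sym (fromℕ-homo-^ x j)) ⟩
    1ℚ ℚ.* P                           ≡⟨ ℚ.*-identityˡ P ⟩
    P                                  ∎
  F*a : F ℚ.* a ≡ fromℕ (rising x j)
  F*a = begin
    F ℚ.* a                            ≡⟨ ℚ.*-comm F a ⟩
    a ℚ.* F                            ≡⟨ fromℕ-homo-* ((x ℕ.+ j) C j) (j !) ⟨
    fromℕ (((x ℕ.+ j) C j) ℕ.* j !)    ≡⟨ cong fromℕ (C-*-! x j) ⟩
    fromℕ (rising x j)                 ∎
  b≤a : b ℚ.≤ a
  b≤a = ℚ.*-cancelˡ-≤-pos F (subst₂ ℚ._≤_ (sym F*b) (sym F*a) (fromℕ-mono-≤ (^≤rising x j)))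
  a< : a ℚ.< b ℚ.+ ε ℚ.* b
  -- Multiplying by j! x clears the 1 / j! in b and the 1 / x in the relative error, leaving
  -- `*-rising≤` over the naturals.
  a< = ℚ.*-cancelˡ-<-nonNeg (F ℚ.* X) {{ℚ.pos⇒nonNeg (F ℚ.* X)}} (R.begin-strict
    F ℚ.* X ℚ.* a                                    R.≡⟨ swap F X a ⟩
    X ℚ.* (F ℚ.* a)                                  R.≡⟨ cong (X ℚ.*_) F*a ⟩
    X ℚ.* fromℕ (rising x j)                         R.≡⟨ fromℕ-homo-* x (rising x j) ⟨
    fromℕ (x ℕ.* rising x j)                         R.≤⟨ fromℕ-mono-≤ (*-rising≤ x j 1≤x) ⟩
    fromℕ ((x ℕ.+ risingError j) ℕ.* x ℕ.^ j)
      R.≡⟨ fromℕ-homo-* (x ℕ.+ risingError j) (x ℕ.^ j) ⟩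
    fromℕ (x ℕ.+ risingError j) ℚ.* P
      R.≡⟨ cong (ℚ._* P) (fromℕ-homo-+ x (risingError j)) ⟩
    (X ℚ.+ fromℕ (risingError j)) ℚ.* P
      R.<⟨ ℚ.*-monoˡ-<-pos P (ℚ.+-monoʳ-< X K<) ⟩
    (X ℚ.+ ε ℚ.* X) ℚ.* P                            R.≡⟨ cong ((X ℚ.+ ε ℚ.* X) ℚ.*_) F*b ⟨
    (X ℚ.+ ε ℚ.* X) ℚ.* (F ℚ.* b)                    R.≡⟨ expand F X b ε ⟩
    F ℚ.* X ℚ.* (b ℚ.+ ε ℚ.* b)                      R.∎)
    where
    module R = ℚ.≤-Reasoning
    swap : ∀ f x a → f ℚ.* x ℚ.* a ≡ x ℚ.* (f ℚ.* a)
    swap = solve 3 (λ f x a → f :* x :* a := x :* (f :* a)) refl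
    expand : ∀ f x b ε → (x ℚ.+ ε ℚ.* x) ℚ.* (f ℚ.* b) ≡ f ℚ.* x ℚ.* (b ℚ.+ ε ℚ.* b)
    expand = solve 4 (λ f x b ε → (x :+ ε :* x) :* (f :* b) := f :* x :* (b :+ ε :* b)) refl

-- The slope d/2 - 1

half-2* : ∀ m → fromℕ (2 ℕ.* m) ℚ.* ½ ≡ fromℕ m
half-2* m = begin
  fromℕ (2 ℕ.* m) ℚ.* ½          ≡⟨ cong (ℚ._* ½) (fromℕ-homo-* 2 m) ⟩
  fromℕ 2 ℚ.* fromℕ m ℚ.* ½      ≡⟨ cancel (fromℕ m) ⟩
  fromℕ m                        ∎
  where
  open +-*-Solver
  cancel : ∀ m → fromℕ 2 ℚ.* m ℚ.* ½ ≡ m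
  cancel = solve 1 (λ m → con (fromℕ 2) :* m :* con ½ := m) refl

-- The slope occurs as d/2 - 1 in the cycle rank and as (d - 2)/2 in the asymptotics.
half-d-2 : ∀ d → (+ d ℤ.- + 2) / 2 ≡ + d / 2 ℚ.- 1ℚ
half-d-2 d = begin
  (+ d ℤ.- + 2) / 2                        ≡⟨ /2≡/1*½ (+ d ℤ.- + 2) ⟩
  (+ d ℤ.- + 2) / 1 ℚ.* ½                  ≡⟨ cong (ℚ._* ½) (/1-homo-+ (+ d) -[1+ 1 ]) ⟩
  (+ d / 1 ℚ.+ -[1+ 1 ] / 1) ℚ.* ½         ≡⟨ ℚ.*-distribʳ-+ ½ (+ d / 1) (-[1+ 1 ] / 1) ⟩
  + d / 1 ℚ.* ½ ℚ.- 1ℚ                     ≡⟨ cong (ℚ._- 1ℚ) (/2≡/1*½ (+ d)) ⟨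
  + d / 2 ℚ.- 1ℚ                           ∎

[d/2-1]*n : ∀ d n x → 2 ℕ.* n ℕ.+ 2 ℕ.* x ≡ n ℕ.* d →
  (+ d / 2 ℚ.- 1ℚ) ℚ.* fromℕ n ≡ fromℕ x
[d/2-1]*n d n x eq = begin
  (+ d / 2 ℚ.- 1ℚ) ℚ.* fromℕ n
    ≡⟨ cong (λ q → (q ℚ.- 1ℚ) ℚ.* fromℕ n) (/2≡/1*½ (+ d)) ⟩
  (fromℕ d ℚ.* ½ ℚ.- 1ℚ) ℚ.* fromℕ n
    ≡⟨ expand (fromℕ d) (fromℕ n) ⟩
  fromℕ n ℚ.* fromℕ d ℚ.* ½ ℚ.- fromℕ n
    ≡⟨ cong (λ q → q ℚ.* ½ ℚ.- fromℕ n) (fromℕ-homo-* n d) ⟨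
  fromℕ (n ℕ.* d) ℚ.* ½ ℚ.- fromℕ n
    ≡⟨ cong (λ m → fromℕ m ℚ.* ½ ℚ.- fromℕ n) (trans (sym eq) (sym (ℕ.*-distribˡ-+ 2 n x))) ⟩
  fromℕ (2 ℕ.* (n ℕ.+ x)) ℚ.* ½ ℚ.- fromℕ n
    ≡⟨ cong (ℚ._- fromℕ n) (trans (half-2* (n ℕ.+ x)) (fromℕ-homo-+ n x)) ⟩
  fromℕ n ℚ.+ fromℕ x ℚ.- fromℕ n
    ≡⟨ cancel (fromℕ n) (fromℕ x) ⟩
  fromℕ x ∎
  where
  open +-*-Solver
  expand : ∀ d n → (d ℚ.* ½ ℚ.- 1ℚ) ℚ.* n ≡ n ℚ.* d ℚ.* ½ ℚ.- n
  expand = solve 2 (λ d n → (d :* con ½ :- con 1ℚ) :* n := n :* d :* con ½ :- n) refl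
  cancel : ∀ n x → n ℚ.+ x ℚ.- n ≡ x
  cancel = solve 2 (λ n x → n :+ x :- n := x) refl

-- From a single graph to families

h≡cycleRankC : ∀ {n d j g} (G : Graph n) (order : EdgeOrder G) → 3 ℕ.≤ d → Regular G d →
  IsGirth G g → j ℕ.+ 2 ℕ.≤ g → h G order j ≡ + ((cycleRank G ℕ.+ j ∸ 1) C j)
h≡cycleRankC {n} {d} {j} {g} G order 3≤d regular girth@((vs , cycle) , _) j+2≤g = begin
  coeff (hPoly faceCount (n ∸ 1)) j
    ≡⟨ cong (λ r → coeff (hPoly faceCount r) j) n∸1≡ ⟩
  coeff (hPoly faceCount (j ℕ.+ s)) j
    ≡⟨ coeff-hPoly-simplex faceCount j s (x ℕ.+ j) faceCount≡ ⟩
  + ((x ℕ.+ j) C j)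
    ≡⟨ cong (λ m → + (m C j)) (cycleRank+j∸1 G 3≤d regular j) ⟨
  + ((cycleRank G ℕ.+ j ∸ 1) C j) ∎
  where
  open BC G order using (faceCount)
  x s : ℕ
  x = excess G 3≤d regular
  s = n ∸ suc j
  2+j≤g : 2 ℕ.+ j ℕ.≤ g
  2+j≤g = ℕ.≤-trans (ℕ.≤-reflexive (ℕ.+-comm 2 j)) j+2≤g
  -- A shortest cycle has g distinct vertices, so n ≥ g ≥ j + 2 and the subtraction defining s is
  -- exact. With rank n - 1 this s is r - j.
  n≡ : suc j ℕ.+ s ≡ n
  n≡ = ℕ.m+[n∸m]≡n (ℕ.≤-trans (ℕ.n≤1+n (suc j)) (ℕ.≤-trans 2+j≤g (cycle-length≤n G vs cycle)))
  n∸1≡ : n ∸ 1 ≡ j ℕ.+ s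
  n∸1≡ = cong (_∸ 1) (sym n≡)
  edgeCount≡ : edgeCount G ≡ suc (s ℕ.+ (x ℕ.+ j))
  edgeCount≡ = begin
    edgeCount G                        ≡⟨ n+excess G 3≤d regular ⟨
    n ℕ.+ x                            ≡⟨ cong (ℕ._+ x) n≡ ⟨
    suc j ℕ.+ s ℕ.+ x                  ≡⟨ rearrange j s x ⟩
    suc (s ℕ.+ (x ℕ.+ j))              ∎
    where
    rearrange : ∀ j s x → suc j ℕ.+ s ℕ.+ x ≡ suc (s ℕ.+ (x ℕ.+ j))
    rearrange = ℕ.solve-∀
  faceCount≡ : ∀ {i} → i ℕ.≤ j → faceCount i ≡ suc (s ℕ.+ (x ℕ.+ j)) C i
  faceCount≡ {i} i≤j = trans
    (faceCount-small G order girth (ℕ.≤-trans (s≤s (s≤s i≤j)) 2+j≤g))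
    (cong (_C i) edgeCount≡)

module _ {d : ℕ} (3≤d : 3 ℕ.≤ d) (F : RegularFamily d) where
  open RegularFamily F

  private
    x : ∀ N (i : Index N) → ℕ
    x N i = excess (graph N i) 3≤d (regular N i)

    [d/2-1]*N : ∀ N (i : Index N) → (+ d / 2 ℚ.- 1ℚ) ℚ.* fromℕ N ≡ fromℕ (x N i)
    [d/2-1]*N N i = [d/2-1]*n d N (x N i) (2*n+2*excess (graph N i) 3≤d (regular N i))

  cycleRankFormula : CycleRankFormula F
  cycleRankFormula N i = begin
    fromℕ (cycleRank (graph N i))
      ≡⟨ cong fromℕ (cycleRank-excess (graph N i) 3≤d (regular N i)) ⟩
    fromℕ (x N i ℕ.+ 1)
      ≡⟨ fromℕ-homo-+ (x N i) 1 ⟩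
    fromℕ (x N i) ℚ.+ 1ℚ
      ≡⟨ cong (ℚ._+ 1ℚ) ([d/2-1]*N N i) ⟨
    (+ d / 2 ℚ.- 1ℚ) ℚ.* fromℕ N ℚ.+ 1ℚ ∎

  hFormula : ∀ j → GirthEventually≥ F (j ℕ.+ 2) → ∀ order → HFormula F j order
  hFormula j (M , girth) order = M , λ N i M≤N →
    let (g , isGirth , j+2≤g) = girth N i M≤N
    in h≡cycleRankC (graph N i) (order N i) 3≤d (regular N i) isGirth j+2≤g

  hAsymptotics : ∀ j order → HFormula F j order → HAsymptotics F j order
  -- With t ≥ K / ε, the bounds 2(t + 1) ≤ N ≤ 2x give x ≥ t + 1 > K / ε. The added 1 yields both
  -- the strict inequality and x ≥ 1.
  hAsymptotics j order (M , h≡) ε ε>0 = M ℕ.⊔ 2 ℕ.* suc t , close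
    where
    instance
      ε-pos : ℚ.Positive ε
      ε-pos = ℚ.positive ε>0
      _ = ℚ.pos⇒nonZero ε
    K : ℚ
    K = fromℕ (risingError j)
    K/ε≤t = archimedean (K ÷ ε)
    t : ℕ
    t = proj₁ K/ε≤t

    K<ε*x : ∀ {x} → suc t ℕ.≤ x → K ℚ.< ε ℚ.* fromℕ x
    K<ε*x {x} t<x = R.begin-strict
      K                         R.≡⟨ cancel ⟨
      ε ℚ.* (K ÷ ε)             R.≤⟨ ℚ.*-monoˡ-≤-nonNeg ε {{ℚ.pos⇒nonNeg ε}} (proj₂ K/ε≤t) ⟩
      ε ℚ.* fromℕ t             R.<⟨ ℚ.*-monoʳ-<-pos ε (fromℕ-mono-< t<x) ⟩
      ε ℚ.* fromℕ x             R.∎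
      where
      module R = ℚ.≤-Reasoning
      cancel : ε ℚ.* (K ÷ ε) ≡ K
      cancel = trans (ℚ.*-comm ε (K ÷ ε)) (trans (ℚ.*-assoc K (ℚ.1/ ε) ε)
        (trans (cong (K ℚ.*_) (ℚ.*-inverseˡ ε)) (ℚ.*-identityʳ K)))

    close : ∀ N (i : Index N) → M ℕ.⊔ 2 ℕ.* suc t ℕ.≤ N →
      RatioWithin ε (h (graph N i) (order N i) j / 1)
        (_/_ 1ℤ (j !) {{j ℕ.!≢0}} ℚ.* ((((+ d ℤ.- + 2) / 2) ℚ.* fromℕ N) ^ℚ j))
    -- `RatioWithin` bundles the proof that b is nonzero, so b can be replaced although the quotient
    -- depends on that proof.
    close N i ≤N = subst₂ (RatioWithin ε)
      (sym (cong (_/ 1) (trans (h≡ N i (ℕ.m⊔n≤o⇒m≤o M _ ≤N))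
        (cong (λ m → + (m C j)) (cycleRank+j∸1 (graph N i) 3≤d (regular N i) j)))))
      (sym (cong (λ y → _/_ 1ℤ (j !) {{j ℕ.!≢0}} ℚ.* y ^ℚ j)
        (trans (cong (ℚ._* fromℕ N) (half-d-2 d)) ([d/2-1]*N N i))))
      (C-close (x N i) j ε (ℕ.≤-trans (s≤s z≤n) t<x) (K<ε*x t<x))
      where
      t<x : suc t ℕ.≤ x N i
      t<x = ℕ.*-cancelˡ-≤ 2 (ℕ.≤-trans (ℕ.m⊔n≤o⇒n≤o M _ ≤N)
                                       (n≤2*excess (graph N i) 3≤d (regular N i)))

  regularFamily-h : ∀ j → GirthEventually≥ F (j ℕ.+ 2) → ∀ order →
    CycleRankFormula F × HFormula F j order × HAsymptotics F j order
  regularFamily-h j girth order =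
    cycleRankFormula , hFormula j girth order , hAsymptotics j order (hFormula j girth order)

corollary8p2 : (d : ℕ) → 3 ≤ d →
    ((F : RegularFamily d) (j : ℕ) → GirthEventually≥ F (j + 2) →
    (order : EdgeOrders F) →
    CycleRankFormula F × HFormula F j order × HAsymptotics F j order)
    ×
    ((F : RegularFamily d) →
    (∀ N (i : RegularFamily.Index F N) → IsRamanujan (RegularFamily.graph F N i) d) →
    (j : ℕ) → GirthEventually≥ F (j + 2) →
    (order : EdgeOrders F) →
    CycleRankFormula F × HFormula F j order × HAsymptotics F j order)
corollary8p2 d 3≤d = regularFamily-h 3≤d , λ F _ → regularFamily-h 3≤d F
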